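{- Let $0<\varepsilon<1$. For every instance, every optimal schedule $\mathrm{OPT}$ for the total flow time objective, and every time $t$, $$|\mathrm{SLF}(t)|\le \lceil 1/\varepsilon\rceil\cdot|\mathrm{OPT}(t)|,$$ where $\mathrm{SLF}(t)$ and $\mathrm{OPT}(t)$ denote the sets of jobs that are active at time $t$ in the schedule of the algorithm SLF and in the optimal schedule, respectively.
   Context: **Problem.** An instance is a finite set of jobs. Job $j$ has a release (arrival) time $\ge 0$ and a processing time $p_j>0$. A single machine of unit speed processes the jobs; preemption is allowed at no cost, and the machine may be time-shared (job rates are nonnegative and sum to at most $1$). A job may only be processed after its release and completes when it has received $p_j$ units of processing. A job is active at time $t$ in a schedule if it has been released (release time at most $t$) and is not finished at time $t$. The flow time of a job is its completion time minus its release time; an optimal schedule (computed offline with full knowledge of the instance) minimizes the sum of the flow times of all jobs. **Algorithm SLF (Shortest Lower-Bound First).** At time $t$, in the schedule of SLF, let $e_j(t)$ be the amount of processing job $j$ has received up to time $t$ and $r_j(t)=p_j-e_j(t)$ its remaining processing time. An active job $j$ is *known* at time $t$ if $r_j(t)\le \varepsilon p_j$ and *unknown* otherwise; $K(t)$ and $U(t)$ denote the sets of known and unknown active jobs. The estimate of an active job is $\eta_j(t)=\frac{\varepsilon}{1-\varepsilon}e_j(t)$ if $j\in U(t)$ and $\eta_j(t)=r_j(t)$ if $j\in K(t)$. At each time $t$ with at least one active job, SLF does the following, where a minimum over the empty set is $+\infty$: 1. If $\min_{j\in K(t)}\eta_j(t)\le\min_{j\in U(t)}\eta_j(t)$, it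 processes an arbitrary known job with minimum $\eta_j(t)$. 2. Otherwise, it processes all unknown jobs with minimum $\eta_j(t)$ in parallel at an equal rate (Round-Robin with infinitesimally small steps). -}

module Defs where

open import Level using (Level; _⊔_) renaming (suc to lsuc)
open import Algebra.Bundles using (CommutativeRing)
open import Data.Bool.Base using (if_then_else_)
open import Data.Fin.Base using (Fin)
open import Data.Fin.Subset using (Subset; _∈_; _∉_; ∣_∣; ⁅_⁆) renaming (⊥ to ∅)
open import Data.Nat.Base using (ℕ; zero; suc)
open import Data.Product.Base using (Σ-syntax; ∃-syntax; _×_; proj₁)
open import Data.Vec.Base using (tabulate)
open import Function.Bundles using (_⇔_)
open import Relation.Binary.Core using (Rel)
open import Relation.Binary.Structures using (IsDecTotalOrder)
open import Relation.Nullary using (¬_; Dec; does)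
open import Relation.Nullary.Decidable using (_×-dec_)
import Algebra.Definitions.RawMonoid as RawMonoidDefinitions
import Relation.Binary.Construct.NonStrictToStrict as ToStrict

-- Times, amounts of work and ε live in an arbitrary Archimedean ordered
-- field.  The real numbers (read classically, so that their order is
-- decidable) are such a field, and so are the rationals.
record ArchimedeanOrderedField (c ℓ₁ ℓ₂ : Level) : Set (lsuc (c ⊔ ℓ₁ ⊔ ℓ₂)) where
  infix 4 _≤_ _<?_
  infix 8 _⁻¹

  field
    commutativeRing : CommutativeRing c ℓ₁

  open CommutativeRing commutativeRing public
    using (Carrier; _≈_; _≉_; _+_; _*_; -_; _-_; 0#; 1#; +-rawMonoid)

  field
    _≤_             : Rel Carrier ℓ₂
    isDecTotalOrder : IsDecTotalOrder _≈_ _≤_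
    0≉1             : 0# ≉ 1#
    +-monoˡ-≤       : ∀ z {x y} → x ≤ y → x + z ≤ y + z
    *-nonneg        : ∀ {x y} → 0# ≤ x → 0# ≤ y → 0# ≤ x * y
    -- A total operation; its value at 0# is unconstrained.
    _⁻¹             : Carrier → Carrier
    *-inverseʳ      : ∀ {x} → x ≉ 0# → x * x ⁻¹ ≈ 1#

  open IsDecTotalOrder isDecTotalOrder public using (_≟_; _≤?_)
  open ToStrict _≈_ _≤_ public using (_<_)
  open RawMonoidDefinitions +-rawMonoid public using (sum) renaming (_×_ to _·_)

  field
    archimedean     : ∀ x → ∃[ n ] x ≤ n · 1#

  _<?_ : ∀ x y → Dec (x < y)
  _<?_ = ToStrict.<-decidable _≈_ _≤_ _≟_ _≤?_

  -- Lowers n as long as the result is still an upper bound for x.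
  leastFrom : Carrier → ℕ → ℕ
  leastFrom x zero    = zero
  leastFrom x (suc n) = if does (x ≤? n · 1#) then leastFrom x n else suc n

  -- The least natural number that is at least x; this is the usual ceiling
  -- when x > -1.
  ⌈_⌉ : Carrier → ℕ
  ⌈ x ⌉ = leastFrom x (proj₁ (archimedean x))

module Scheduling {c ℓ₁ ℓ₂} (F : ArchimedeanOrderedField c ℓ₁ ℓ₂) where
  open ArchimedeanOrderedField F

  record Instance : Set (c ⊔ ℓ₁ ⊔ ℓ₂) where
    field
      #jobs     : ℕ
      release   : Fin #jobs → Carrier
      size      : Fin #jobs → Carrier
      release≥0 : ∀ j → 0# ≤ release j
      size>0    : ∀ j → 0# < size j

    Job : Set
    Job = Fin #jobs

  -- A schedule is given by the cumulative work e j t that job j has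
  -- received up to time t.  Over the reals, monotonicity and unit-speed say
  -- exactly that e j is the integral of a nonnegative rate, with the rates of
  -- all jobs summing to at most 1 (the e j are then Lipschitz, hence
  -- absolutely continuous).  Every job is completed at some time: otherwise
  -- the total flow time would not be defined.
  record Schedule (I : Instance) : Set (c ⊔ ℓ₁ ⊔ ℓ₂) where
    open Instance I
    field
      e                 : Job → Carrier → Carrier
      e-mono            : ∀ j {s t} → s ≤ t → e j s ≤ e j t
      unit-speed        : ∀ {s t} → s ≤ t → sum (λ j → e j t - e j s) ≤ t - s
      e-before-release  : ∀ j {t} → t ≤ release j → e j t ≈ 0#
      e≤size            : ∀ j t → e j t ≤ size j
      completion        : Job → Carrier
      completed         : ∀ j → e j (completion j) ≈ size j
      before-completion : ∀ j {t} → t < completion j → e j t < size j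

    remaining : Job → Carrier → Carrier
    remaining j t = size j - e j t

    Active : Job → Carrier → Set (ℓ₁ ⊔ ℓ₂)
    Active j t = release j ≤ t × e j t < size j

    active? : ∀ j t → Dec (Active j t)
    active? j t = (release j ≤? t) ×-dec (e j t <? size j)

    activeSet : Carrier → Subset #jobs
    activeSet t = tabulate (λ j → does (active? j t))

    totalFlowTime : Carrier
    totalFlowTime = sum (λ j → completion j - release j)

  open Schedule public using (activeSet; totalFlowTime)

  IsOptimal : ∀ {I} → Schedule I → Set (c ⊔ ℓ₁ ⊔ ℓ₂)
  IsOptimal {I} S = (S′ : Schedule I) → totalFlowTime S ≤ totalFlowTime S′

  module _ (ε : Carrier) {I : Instance} (S : Schedule I) where
    open Instance I
    open Schedule S hiding (activeSet; totalFlowTime)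

    Known : Job → Carrier → Set (ℓ₁ ⊔ ℓ₂)
    Known j t = Active j t × remaining j t ≤ ε * size j

    Unknown : Job → Carrier → Set (ℓ₁ ⊔ ℓ₂)
    Unknown j t = Active j t × ¬ (remaining j t ≤ ε * size j)

    -- Only meaningful for active jobs.
    η : Job → Carrier → Carrier
    η j t = if does (remaining j t ≤? ε * size j)
            then remaining j t
            else ε * (1# - ε) ⁻¹ * e j t

    MinKnown : Job → Carrier → Set (ℓ₁ ⊔ ℓ₂)
    MinKnown k t = Known k t × (∀ i → Known i t → η k t ≤ η i t)

    MinUnknown : Job → Carrier → Set (ℓ₁ ⊔ ℓ₂)
    MinUnknown u t = Unknown u t × (∀ i → Unknown i t → η u t ≤ η i t)

    -- "k attains the minimum of η over the known jobs, and this minimum is at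
    -- most the minimum over the unknown jobs".  As a minimum over the empty
    -- set is +∞, the comparison holds when only K(t) is nonempty and fails
    -- when only U(t) is.
    FirstRule : Job → Carrier → Set (ℓ₁ ⊔ ℓ₂)
    FirstRule k t = MinKnown k t × (∀ u → Unknown u t → η k t ≤ η u t)

    -- Processes t A: at time t, the algorithm may choose A as the set of jobs
    -- that share the machine equally from t on.
    data Processes (t : Carrier) : Subset #jobs → Set (ℓ₁ ⊔ ℓ₂) where
      idle    : (∀ j → ¬ Active j t) → Processes t ∅
      known   : ∀ k → FirstRule k t → Processes t ⁅ k ⁆
      unknown : ∀ A → (∃[ j ] Active j t) → ¬ (∃[ k ] FirstRule k t) →
                (∀ j → (j ∈ A) ⇔ MinUnknown j t) → Processes t A

    -- On [t , u] every job of A is processed at rate 1 / ∣ A ∣ and every other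
    -- job at rate 0, and A is a choice of the algorithm at each time of
    -- [t , u).
    record Phase (t u : Carrier) (A : Subset #jobs) : Set (c ⊔ ℓ₁ ⊔ ℓ₂) where
      field
        chosen  : ∀ {s} → t ≤ s → s < u → Processes s A
        served  : ∀ {s} → t ≤ s → s ≤ u → ∀ j → j ∈ A →
                  ∣ A ∣ · (e j s - e j t) ≈ s - t
        waiting : ∀ {s} → t ≤ s → s ≤ u → ∀ j → j ∉ A → e j s ≈ e j t

    -- The Round-Robin with infinitesimally small steps keeps minimal unknown
    -- jobs tied, so the set of processed jobs changes only at finitely many
    -- times: when a job is released, becomes known or completes, or when the
    -- estimate of the processed unknown jobs reaches that of another job.
    data Phases : Carrier → Carrier → Set (c ⊔ ℓ₁ ⊔ ℓ₂) where
      []  : ∀ {t u} → t ≈ u → Phases t u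
      _∷_ : ∀ {t u v} → (t < u) × (Σ[ A ∈ Subset #jobs ] Phase t u A) →
            Phases u v → Phases t v

    IsSLF : Set (c ⊔ ℓ₁ ⊔ ℓ₂)
    IsSLF = ∀ T → 0# ≤ T → Phases 0# T

{-# OPTIONS --safe #-}

-- Write N = ⌈1/ε⌉ and κ = ε/(1-ε).  Up to its completion a job of size p that
-- has received e has estimate min (p - e , κ e), which is at most the remaining
-- work p - e.  For every threshold θ = ε v, the remaining work of the jobs in
-- SLF is measured by Σ potential v p e, where
--   potential v p e = max (min (p , v) - e , min (p - e , θ)),
-- and that in an arbitrary schedule S by Σ min (r , N θ), r being the remaining
-- work in S.  For all θ and all times, the first sum is at most the second;
-- small θ then gives the claim.
--
-- The inequality is preserved during each phase of SLF.  If the estimates of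
-- the processed jobs stay below θ, then the first sum decreases at unit rate,
-- and no schedule can decrease the second sum faster.  If they exceed θ at some
-- point, let Λ be their maximum in the phase: at the end of the phase every
-- active job but one has remaining work at least Λ, and the inequality for θ
-- follows from the one for Λ, which is covered by the first case.
module Submission where

open import Defs
open import Data.Nat.Base using () renaming (_≤_ to _≤ℕ_; _*_ to _*ℕ_)
open import Data.Fin.Subset using (∣_∣)

open import Algebra.Bundles using (CommutativeRing; RawRing)
import Algebra.Construct.NaturalChoice.Max as Max
import Algebra.Construct.NaturalChoice.Min as Min
import Algebra.Properties.CommutativeMonoid.Sum as SumProperties
import Algebra.Properties.CommutativeSemigroup as CommutativeSemigroupProperties
import Algebra.Properties.Monoid.Mult as MultProperties
import Algebra.Properties.Ring as RingProperties
import Algebra.Properties.Semiring.Mult as SemiringMultProperties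
import Algebra.Solver.Ring as RingSolver
import Algebra.Solver.Ring.AlmostCommutativeRing as ACR
open import Data.Bool.Base using (if_then_else_)
open import Data.Fin.Base using (Fin; zero; suc; punchIn)
open import Data.Fin.Properties using (punchInᵢ≢i; any?) renaming (_≟_ to _≟ᶠ_)
open import Data.Fin.Subset using (Subset; _∈_; _∉_; inside; outside; Nonempty)
open import Data.Fin.Subset.Properties
  using (nonempty?; ∉⊥; x∈⁅x⁆; x∈⁅y⁆⇒x≡y; x∈p⇒∣p-x∣<∣p∣; _∈?_; drop-there)
open import Data.Maybe.Base using (just; nothing)
open import Data.Nat.Base as ℕ using (ℕ; zero; suc)
import Data.Nat.Properties as ℕ
open import Data.Product.Base using (∃-syntax; _×_; _,_; proj₁; proj₂)
open import Data.Sum.Base using (_⊎_; inj₁; inj₂)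
open import Data.Vec.Base using (_∷_; []; here; there; tabulate)
open import Data.Vec.Functional using (removeAt)
open import Function.Base using (_∘_; case_of_)
open import Function.Bundles using (Equivalence)
open import Level using (Level)
open import Relation.Binary.Bundles using (TotalOrder)
open import Relation.Binary.Definitions using (WeaklyDecidable)
open import Relation.Binary.PropositionalEquality as ≡ using (_≡_; _≢_; ≢-sym)
import Relation.Binary.Reasoning.PartialOrder as PartialOrderReasoning
import Relation.Binary.Reasoning.Setoid as SetoidReasoning
open import Relation.Binary.Structures using (IsDecTotalOrder)
open import Relation.Nullary using (¬_; Dec; yes; no; does; contradiction)

-- Ring solver over formal differences of naturals

module DifferenceSolver {c ℓ} (R : CommutativeRing c ℓ) where
  open CommutativeRing R renaming (refl to ≈-refl; sym to ≈-sym; trans to ≈-trans)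
  open RingProperties ring using (-‿+-comm; -‿distribˡ-*; -‿distribʳ-*; -‿involutive)
  open CommutativeSemigroupProperties +-commutativeSemigroup
    using () renaming (interchange to +-interchange)
  open MultProperties +-monoid using () renaming (_×_ to _·_; ×-homo-+ to ·-homo-+)
  open SemiringMultProperties semiring using (×1-homo-*)
  open SetoidReasoning setoid

  -- Formal differences of naturals serve as coefficients because the solver
  -- must compute with them to cancel x - x.
  private
    Difference : RawRing _ _
    Difference = record
      { Carrier = ℕ × ℕ
      ; _≈_     = _≡_
      ; _+_     = λ (a , b) (c , d) → a ℕ.+ c , b ℕ.+ d
      ; _*_     = λ (a , b) (c , d) → a ℕ.* c ℕ.+ b ℕ.* d , a ℕ.* d ℕ.+ b ℕ.* c
      ; -_      = λ (a , b) → b , a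
      ; 0#      = 0 , 0
      ; 1#      = 1 , 0
      }

    difference-homo : Difference ACR.-Raw-AlmostCommutative⟶ ACR.fromCommutativeRing R
    difference-homo = record
      { ⟦_⟧    = λ (a , b) → a · 1# - b · 1#
      ; +-homo = λ (a , b) (c , d) → begin
          (a ℕ.+ c) · 1# - (b ℕ.+ d) · 1#
            ≈⟨ +-cong (·-homo-+ 1# a c) (-‿cong (·-homo-+ 1# b d)) ⟩
          (a · 1# + c · 1#) - (b · 1# + d · 1#)
            ≈⟨ +-congˡ (-‿+-comm _ _) ⟨
          (a · 1# + c · 1#) + (- (b · 1#) - d · 1#)
            ≈⟨ +-interchange _ _ _ _ ⟩
          (a · 1# - b · 1#) + (c · 1# - d · 1#) ∎
      ; *-homo = λ (a , b) (c , d) → begin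
          (a ℕ.* c ℕ.+ b ℕ.* d) · 1# - (a ℕ.* d ℕ.+ b ℕ.* c) · 1#
            ≈⟨ +-cong (homo a c b d) (-‿cong (homo a d b c)) ⟩
          (a · 1# * c · 1# + b · 1# * d · 1#) - (a · 1# * d · 1# + b · 1# * c · 1#)
            ≈⟨ +-congˡ (-‿+-comm _ _) ⟨
          (a · 1# * c · 1# + b · 1# * d · 1#) + (- (a · 1# * d · 1#) - b · 1# * c · 1#)
            ≈⟨ +-congˡ (+-comm _ _) ⟩
          (a · 1# * c · 1# + b · 1# * d · 1#) + (- (b · 1# * c · 1#) - a · 1# * d · 1#)
            ≈⟨ +-interchange _ _ _ _ ⟩
          (a · 1# * c · 1# - b · 1# * c · 1#) + (b · 1# * d · 1# - a · 1# * d · 1#)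
            ≈⟨ +-cong (+-congˡ (-‿distribˡ-* _ _)) (+-comm _ _) ⟩
          (a · 1# * c · 1# + - (b · 1#) * c · 1#) + (- (a · 1# * d · 1#) + b · 1# * d · 1#)
            ≈⟨ +-cong (≈-sym (distribʳ _ _ _))
                      (+-cong (-‿distribʳ-* _ _)
                              (≈-trans (≈-sym (-‿involutive _))
                                       (≈-trans (-‿cong (-‿distribˡ-* _ _)) (-‿distribʳ-* _ _)))) ⟩
          (a · 1# - b · 1#) * c · 1# + (a · 1# * - (d · 1#) + - (b · 1#) * - (d · 1#))
            ≈⟨ +-congˡ (distribʳ _ _ _) ⟨
          (a · 1# - b · 1#) * c · 1# + (a · 1# - b · 1#) * - (d · 1#)
            ≈⟨ distribˡ _ _ _ ⟨
          (a · 1# - b · 1#) * (c · 1# - d · 1#) ∎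
      ; -‿homo = λ (a , b) → begin
          b · 1# - a · 1#         ≈⟨ +-comm _ _ ⟩
          - (a · 1#) + b · 1#     ≈⟨ +-congˡ (-‿involutive _) ⟨
          - (a · 1#) - - (b · 1#) ≈⟨ -‿+-comm _ _ ⟩
          - (a · 1# - b · 1#)     ∎
      ; 0-homo = -‿inverseʳ 0#
      ; 1-homo = ≈-trans (+-assoc _ _ _) (≈-trans (+-congˡ (-‿inverseʳ 0#)) (+-identityʳ 1#))
      }
      where
      homo : ∀ a c b d → (a ℕ.* c ℕ.+ b ℕ.* d) · 1# ≈ a · 1# * c · 1# + b · 1# * d · 1#
      homo a c b d = ≈-trans (·-homo-+ 1# (a ℕ.* c) (b ℕ.* d))
                             (+-cong (×1-homo-* a c) (×1-homo-* b d))

    -- Distinct pairs can denote the same difference. Comparing crosswise in ℕ identifies (1 , 1)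
    -- with (0 , 0), which is how opposite terms vanish.
    cross : ∀ a b c d → a ℕ.+ d ≡ b ℕ.+ c → a · 1# - b · 1# ≈ c · 1# - d · 1#
    cross a b c d a+d≡b+c = begin
      a · 1# - b · 1#                           ≈⟨ +-identityʳ _ ⟨
      (a · 1# - b · 1#) + 0#                    ≈⟨ +-congˡ (-‿inverseʳ (d · 1#)) ⟨
      (a · 1# - b · 1#) + (d · 1# - d · 1#)     ≈⟨ +-interchange _ _ _ _ ⟩
      (a · 1# + d · 1#) + (- (b · 1#) - d · 1#) ≈⟨ +-congʳ (·-homo-+ 1# a d) ⟨
      (a ℕ.+ d) · 1# + (- (b · 1#) - d · 1#)    ≈⟨ +-congʳ (reflexive (≡.cong (_· 1#) a+d≡b+c)) ⟩
      (b ℕ.+ c) · 1# + (- (b · 1#) - d · 1#)    ≈⟨ +-congʳ (·-homo-+ 1# b c) ⟩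
      (b · 1# + c · 1#) + (- (b · 1#) - d · 1#) ≈⟨ +-interchange _ _ _ _ ⟩
      (b · 1# - b · 1#) + (c · 1# - d · 1#)     ≈⟨ +-congʳ (-‿inverseʳ (b · 1#)) ⟩
      0# + (c · 1# - d · 1#)                    ≈⟨ +-identityˡ _ ⟩
      c · 1# - d · 1#                           ∎

    equal? : WeaklyDecidable (ACR.Induced-equivalence difference-homo)
    equal? (a , b) (c , d) with a ℕ.+ d ℕ.≟ b ℕ.+ c
    ... | yes eq = just (cross a b c d eq)
    ... | no _   = nothing

  open RingSolver Difference (ACR.fromCommutativeRing R) difference-homo equal?
    public using (solve; _:=_; _:+_; _:-_; :-_; _:*_)

-- Arithmetic of Archimedean ordered fields

module OrderedField {c ℓ₁ ℓ₂} (F : ArchimedeanOrderedField c ℓ₁ ℓ₂) where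
  open ArchimedeanOrderedField F
  open CommutativeRing commutativeRing public
    using ( +-cong; +-congˡ; +-congʳ; +-comm; +-assoc; +-identityˡ; +-identityʳ
          ; -‿cong; -‿inverseˡ; -‿inverseʳ; *-cong; *-congˡ; *-congʳ; *-comm; *-assoc
          ; *-identityˡ; *-identityʳ; distribʳ; zeroʳ)
  open CommutativeRing commutativeRing
    using (semiring; +-monoid; +-commutativeMonoid; *-commutativeSemigroup)
  open DifferenceSolver commutativeRing public
  open CommutativeSemigroupProperties *-commutativeSemigroup using (x∙yz≈y∙xz)

  open IsDecTotalOrder isDecTotalOrder public
    using (antisym; total; ≤-respˡ-≈; ≤-respʳ-≈)
    renaming (refl to ≤-refl; reflexive to ≤-reflexive; trans to ≤-trans)
  open IsDecTotalOrder isDecTotalOrder using (isTotalOrder)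
  open IsDecTotalOrder.Eq isDecTotalOrder public
    using () renaming (refl to ≈-refl; sym to ≈-sym; trans to ≈-trans; reflexive to ≈-reflexive)

  totalOrder : TotalOrder c ℓ₁ ℓ₂
  totalOrder = record { isTotalOrder = isTotalOrder }

  open Min totalOrder public
  open Max totalOrder public using (_⊔_; x≤x⊔y; x≤y⊔x; ⊔-lub; ⊔-cong)
  open SumProperties +-commutativeMonoid public using (sum-remove; ∑-distrib-+)
  open MultProperties +-monoid public renaming
    (×-congʳ to ·-congʳ; ×-homo-+ to ·-homo-+; ×-assocˡ to ·-assocˡ) using ()
  open SemiringMultProperties semiring using (×-assoc-*)

  module ≤-Reasoning = PartialOrderReasoning (TotalOrder.poset totalOrder)

  -- The equation says that b - a equals r - l, without mentioning the order. This splits a linear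
  -- inequality into a combination of known ones and an identity that the ring solver checks.
  ≤-by : ∀ {a b l r} → l ≤ r → a + r ≈ b + l → a ≤ b
  ≤-by {a} {b} {l} {r} l≤r eq = begin
    a             ≈⟨ solve 2 (λ a r → a := (a :+ r) :- r) ≈-refl a r ⟩
    (a + r) - r   ≈⟨ +-congʳ eq ⟩
    (b + l) - r   ≈⟨ solve 3 (λ b l r → (b :+ l) :- r := l :+ (b :- r)) ≈-refl b l r ⟩
    l + (b - r)   ≤⟨ +-monoˡ-≤ (b - r) l≤r ⟩
    r + (b - r)   ≈⟨ solve 2 (λ b r → r :+ (b :- r) := b) ≈-refl b r ⟩
    b             ∎
    where open ≤-Reasoning

  <⇒≤ : ∀ {x y} → x < y → x ≤ y
  <⇒≤ = proj₁

  <⇒≱ : ∀ {x y} → x < y → ¬ y ≤ x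
  <⇒≱ (x≤y , x≉y) y≤x = x≉y (antisym x≤y y≤x)

  ≰⇒> : ∀ {x y} → ¬ x ≤ y → y < x
  ≰⇒> {x} {y} x≰y with total x y
  ... | inj₁ x≤y = contradiction x≤y x≰y
  ... | inj₂ y≤x = y≤x , λ y≈x → x≰y (≤-reflexive (≈-sym y≈x))

  ≮⇒≥ : ∀ {x y} → ¬ x < y → y ≤ x
  ≮⇒≥ {x} {y} x≮y with y ≤? x
  ... | yes y≤x = y≤x
  ... | no  y≰x = contradiction (≰⇒> y≰x) x≮y

  ≤-<-trans : ∀ {x y z} → x ≤ y → y < z → x < z
  ≤-<-trans x≤y y<z = ≰⇒> λ z≤x → <⇒≱ y<z (≤-trans z≤x x≤y)

  <-≤-trans : ∀ {x y z} → x < y → y ≤ z → x < z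
  <-≤-trans x<y y≤z = ≰⇒> λ z≤x → <⇒≱ x<y (≤-trans y≤z z≤x)

  <-by : ∀ {a b l r} → l < r → a + r ≈ b + l → a < b
  <-by {a} {b} {l} {r} l<r eq = ≰⇒> λ b≤a →
    <⇒≱ l<r (≤-by b≤a (≈-trans (+-comm r a) (≈-trans eq (+-comm b l))))

  +-mono-≤ : ∀ {x y z w} → x ≤ y → z ≤ w → x + z ≤ y + w
  +-mono-≤ {x} {y} {z} {w} x≤y z≤w = ≤-trans (+-monoˡ-≤ z x≤y)
    (≤-by z≤w (solve 3 (λ y z w → (y :+ z) :+ w := (y :+ w) :+ z) ≈-refl y z w))

  +-nonneg : ∀ {x y} → 0# ≤ x → 0# ≤ y → 0# ≤ x + y
  +-nonneg 0≤x 0≤y = ≤-respˡ-≈ (+-identityˡ 0#) (+-mono-≤ 0≤x 0≤y)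

  x-0≈x : ∀ x → x - 0# ≈ x
  x-0≈x x = ≈-trans (≈-sym (+-identityʳ _)) (solve 2 (λ x z → (x :- z) :+ z := x) ≈-refl x 0#)

  x≤y⇒0≤y-x : ∀ {x y} → x ≤ y → 0# ≤ y - x
  x≤y⇒0≤y-x {x} {y} x≤y = ≤-by x≤y
    (≈-trans (+-identityˡ y) (solve 2 (λ x y → y := (y :- x) :+ x) ≈-refl x y))

  0≤y-x⇒x≤y : ∀ {x y} → 0# ≤ y - x → x ≤ y
  0≤y-x⇒x≤y {x} {y} 0≤y-x = ≤-by 0≤y-x
    (≈-trans (solve 2 (λ x y → x :+ (y :- x) := y) ≈-refl x y) (≈-sym (+-identityʳ y)))

  x<y⇒0<y-x : ∀ {x y} → x < y → 0# < y - x
  x<y⇒0<y-x {x} {y} x<y = <-by x<y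
    (≈-trans (+-identityˡ y) (solve 2 (λ x y → y := (y :- x) :+ x) ≈-refl x y))

  0≤1 : 0# ≤ 1#
  0≤1 with total 0# 1#
  ... | inj₁ 0≤1 = 0≤1
  ... | inj₂ 1≤0 = ≤-respʳ-≈
    (≈-trans (solve 1 (λ x → (:- x) :* (:- x) := x :* x) ≈-refl 1#) (*-identityˡ 1#))
    (*-nonneg 0≤-1 0≤-1)
    where
    0≤-1 : 0# ≤ - 1#
    0≤-1 = ≤-by 1≤0 (≈-trans (+-identityʳ 0#) (≈-sym (-‿inverseˡ 1#)))

  0<1 : 0# < 1#
  0<1 = 0≤1 , 0≉1

  *-monoʳ-≤ : ∀ {z} → 0# ≤ z → ∀ {x y} → x ≤ y → z * x ≤ z * y
  *-monoʳ-≤ {z} 0≤z {x} {y} x≤y = 0≤y-x⇒x≤y (≤-respʳ-≈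
    (solve 3 (λ x y z → z :* (y :- x) := z :* y :- z :* x) ≈-refl x y z)
    (*-nonneg 0≤z (x≤y⇒0≤y-x x≤y)))

  ⁻¹-pos : ∀ {x} → 0# < x → 0# < x ⁻¹
  ⁻¹-pos {x} (0≤x , 0≉x) = ≰⇒> λ x⁻¹≤0 → <⇒≱ 0<1
    (≤-respˡ-≈ (*-inverseʳ (0≉x ∘ ≈-sym)) (≤-respʳ-≈ (zeroʳ x) (*-monoʳ-≤ 0≤x x⁻¹≤0)))

  *-⁻¹-cancelˡ : ∀ {z} → 0# < z → ∀ x → z * (z ⁻¹ * x) ≈ x
  *-⁻¹-cancelˡ {z} (_ , 0≉z) x = ≈-trans (≈-sym (*-assoc z (z ⁻¹) x))
    (≈-trans (*-congʳ (*-inverseʳ (0≉z ∘ ≈-sym))) (*-identityˡ x))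

  ⁻¹-*-cancelˡ : ∀ {z} → 0# < z → ∀ x → z ⁻¹ * (z * x) ≈ x
  ⁻¹-*-cancelˡ {z} 0<z x = ≈-trans (x∙yz≈y∙xz (z ⁻¹) z x) (*-⁻¹-cancelˡ 0<z x)

  *-cancelˡ-≤ : ∀ {z} → 0# < z → ∀ {x y} → z * x ≤ z * y → x ≤ y
  *-cancelˡ-≤ 0<z zx≤zy = ≤-respˡ-≈ (⁻¹-*-cancelˡ 0<z _)
    (≤-respʳ-≈ (⁻¹-*-cancelˡ 0<z _) (*-monoʳ-≤ (<⇒≤ (⁻¹-pos 0<z)) zx≤zy))

  *-monoʳ-< : ∀ {z} → 0# < z → ∀ {x y} → x < y → z * x < z * y
  *-monoʳ-< 0<z x<y = ≰⇒> λ zy≤zx → <⇒≱ x<y (*-cancelˡ-≤ 0<z zy≤zx)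

  *-pos : ∀ {x y} → 0# < x → 0# < y → 0# < x * y
  *-pos {x} 0<x 0<y = ≤-<-trans (≤-reflexive (≈-sym (zeroʳ x))) (*-monoʳ-< 0<x 0<y)

  dense : ∀ {x y} → x < y → ∃[ z ] (x < z × z < y)
  dense {x} {y} x<y = z ,
    ≰⇒> (λ z≤x → <⇒≱ x<y (≤-by (+-mono-≤ z≤x z≤x)
      (≈-trans (eq₁ x y) (+-congˡ (≈-sym z+z≈x+y))))) ,
    ≰⇒> (λ y≤z → <⇒≱ x<y (≤-by (+-mono-≤ y≤z y≤z)
      (≈-trans (+-congˡ z+z≈x+y) (eq₂ x y))))
    where
    0<2 : 0# < 1# + 1#
    0<2 = <-≤-trans 0<1 (≤-respˡ-≈ (+-identityʳ 1#) (+-mono-≤ ≤-refl 0≤1))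
    z : Carrier
    z = (1# + 1#) ⁻¹ * (x + y)
    z+z≈x+y : z + z ≈ x + y
    z+z≈x+y = ≈-trans (≈-sym (≈-trans (distribʳ z 1# 1#) (+-cong (*-identityˡ z) (*-identityˡ z))))
                      (*-⁻¹-cancelˡ 0<2 (x + y))
    eq₁ : ∀ x y → y + (x + x) ≈ x + (x + y)
    eq₁ = solve 2 (λ x y → y :+ (x :+ x) := x :+ (x :+ y)) ≈-refl
    eq₂ : ∀ x y → y + (x + y) ≈ x + (y + y)
    eq₂ = solve 2 (λ x y → y :+ (x :+ y) := x :+ (y :+ y)) ≈-refl

  ⊓-pos : ∀ {x y} → 0# < x → 0# < y → 0# < x ⊓ y
  ⊓-pos {x} {y} 0<x 0<y with total x y
  ... | inj₁ _ = 0<x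
  ... | inj₂ _ = 0<y

  ⊓-≤-split : ∀ {x y z} → x ⊓ y ≤ z → x ≤ z ⊎ y ≤ z
  ⊓-≤-split {x} {y} le with total x y
  ... | inj₁ _ = inj₁ le
  ... | inj₂ _ = inj₂ le

  ·-nonneg : ∀ n {x} → 0# ≤ x → 0# ≤ n · x
  ·-nonneg zero    0≤x = ≤-refl
  ·-nonneg (suc n) 0≤x = +-nonneg 0≤x (·-nonneg n 0≤x)

  ·-monoʳ-≤ : ∀ n {x y} → x ≤ y → n · x ≤ n · y
  ·-monoʳ-≤ zero    x≤y = ≤-refl
  ·-monoʳ-≤ (suc n) x≤y = +-mono-≤ x≤y (·-monoʳ-≤ n x≤y)

  ·-monoʳ-< : ∀ {n} → 0 ℕ.< n → ∀ {x y} → x < y → n · x < n · y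
  ·-monoʳ-< {suc n} _ x<y = ≰⇒> λ ny≤nx → <⇒≱ x<y (≤-by
    (+-mono-≤ ny≤nx (·-monoʳ-≤ n (<⇒≤ x<y)))
    (solve 4 (λ x y nx ny → y :+ ((x :+ nx) :+ ny) := x :+ ((y :+ ny) :+ nx)) ≈-refl
      _ _ (n · _) (n · _)))

  ·-cancelˡ-≤ : ∀ {n} → 0 ℕ.< n → ∀ {x y} → n · x ≤ n · y → x ≤ y
  ·-cancelˡ-≤ 0<n {x} {y} nx≤ny with x ≤? y
  ... | yes x≤y = x≤y
  ... | no  x≰y = contradiction nx≤ny (<⇒≱ (·-monoʳ-< 0<n (≰⇒> x≰y)))

  ·-cancelˡ : ∀ {n} → 0 ℕ.< n → ∀ {x y} → n · x ≈ n · y → x ≈ y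
  ·-cancelˡ 0<n nx≈ny = antisym (·-cancelˡ-≤ 0<n (≤-reflexive nx≈ny))
                                (·-cancelˡ-≤ 0<n (≤-reflexive (≈-sym nx≈ny)))

  ·-monoˡ-≤ : ∀ {x} → 0# ≤ x → ∀ {m n} → m ≤ℕ n → m · x ≤ n · x
  ·-monoˡ-≤ 0≤x {n = n} ℕ.z≤n       = ·-nonneg n 0≤x
  ·-monoˡ-≤ 0≤x         (ℕ.s≤s m≤n) = +-mono-≤ ≤-refl (·-monoˡ-≤ 0≤x m≤n)

  ·-cancelʳ-≤ : ∀ {x} → 0# < x → ∀ m n → m · x ≤ n · x → m ≤ℕ n
  ·-cancelʳ-≤ {x} 0<x m n mx≤nx = ℕ.≮⇒≥ λ n<m → <⇒≱ 0<x (≤-by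
    (≤-trans (·-monoˡ-≤ (<⇒≤ 0<x) n<m) mx≤nx)
    (≈-trans (+-congˡ (≈-sym (+-identityˡ _)))
             (solve 3 (λ x y z → x :+ (z :+ y) := z :+ (x :+ y)) ≈-refl x (n · x) 0#)))

  x≤⌈x⌉·1 : ∀ x → x ≤ ⌈ x ⌉ · 1#
  x≤⌈x⌉·1 x = x≤leastFrom (proj₁ (archimedean x)) (proj₂ (archimedean x))
    where
    x≤leastFrom : ∀ n → x ≤ n · 1# → x ≤ leastFrom x n · 1#
    x≤leastFrom zero    x≤n = x≤n
    x≤leastFrom (suc n) x≤n with x ≤? n · 1#
    ... | yes x≤n-1 = x≤leastFrom n x≤n-1
    ... | no  _     = x≤n

  -- The bound 1/z ≤ ⌈1/z⌉ multiplied by z x. With z = ε it gives v ≤ N ε v, the only fact about the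
  -- size of N that the argument uses.
  x≤⌈z⁻¹⌉·zx : ∀ {z x} → 0# < z → 0# ≤ x → x ≤ ⌈ z ⁻¹ ⌉ · (z * x)
  x≤⌈z⁻¹⌉·zx {z} {x} 0<z 0≤x = begin
    x                         ≈⟨ *-⁻¹-cancelˡ 0<z x ⟨
    z * (z ⁻¹ * x)            ≈⟨ rotate z (z ⁻¹) x ⟩
    (z * x) * z ⁻¹            ≤⟨ *-monoʳ-≤ (*-nonneg (<⇒≤ 0<z) 0≤x) (x≤⌈x⌉·1 (z ⁻¹)) ⟩
    (z * x) * (⌈ z ⁻¹ ⌉ · 1#) ≈⟨ *-comm _ _ ⟩
    (⌈ z ⁻¹ ⌉ · 1#) * (z * x) ≈⟨ ×-assoc-* ⌈ z ⁻¹ ⌉ 1# (z * x) ⟩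
    ⌈ z ⁻¹ ⌉ · (1# * (z * x)) ≈⟨ ·-congʳ ⌈ z ⁻¹ ⌉ (*-identityˡ (z * x)) ⟩
    ⌈ z ⁻¹ ⌉ · (z * x)        ∎
    where
    open ≤-Reasoning
    rotate : ∀ z w x → z * (w * x) ≈ (z * x) * w
    rotate = solve 3 (λ z w x → z :* (w :* x) := (z :* x) :* w) ≈-refl

-- Finite sums and their truncations

module Sums {c ℓ₁ ℓ₂} (F : ArchimedeanOrderedField c ℓ₁ ℓ₂) where
  open ArchimedeanOrderedField F
  open OrderedField F

  sum-mono-≤ : ∀ {n} {f g : Fin n → Carrier} → (∀ j → f j ≤ g j) → sum f ≤ sum g
  sum-mono-≤ {zero}  f≤g = ≤-refl
  sum-mono-≤ {suc n} f≤g = +-mono-≤ (f≤g zero) (sum-mono-≤ (f≤g ∘ suc))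

  sum-supported : ∀ {n} (A : Subset n) {d : Fin n → Carrier} {δ} →
                  (∀ j → j ∈ A → d j ≈ δ) → (∀ j → j ∉ A → d j ≈ 0#) → sum d ≈ ∣ A ∣ · δ
  sum-supported []            on off = ≈-refl
  sum-supported (inside  ∷ A) on off = +-cong (on zero here)
    (sum-supported A (λ j → on (suc j) ∘ there) (λ j j∉A → off (suc j) (j∉A ∘ drop-there)))
  sum-supported (outside ∷ A) on off = ≈-trans (+-cong (off zero λ ())
    (sum-supported A (λ j → on (suc j) ∘ there) (λ j j∉A → off (suc j) (j∉A ∘ drop-there))))
    (+-identityˡ _)

  module _ {p : Level} {x : Carrier} where

    count·≤sum : ∀ {n} {P : Fin n → Set p} (P? : ∀ j → Dec (P j)) {f : Fin n → Carrier} →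
                 (∀ j → P j → x ≤ f j) → (∀ j → 0# ≤ f j) →
                 ∣ tabulate (does ∘ P?) ∣ · x ≤ sum f
    count·≤sum {zero}  P? x≤f 0≤f = ≤-refl
    count·≤sum {suc n} P? x≤f 0≤f with ih ← count·≤sum (P? ∘ suc) (x≤f ∘ suc) (0≤f ∘ suc) | P? zero
    ... | yes p = +-mono-≤ (x≤f zero p) ih
    ... | no  _ = ≤-respˡ-≈ (+-identityˡ _) (+-mono-≤ (0≤f zero) ih)

    sum≤count· : ∀ {n} {P : Fin n → Set p} (P? : ∀ j → Dec (P j)) {f : Fin n → Carrier} →
                 (∀ j → P j → f j ≤ x) → (∀ j → ¬ P j → f j ≤ 0#) →
                 sum f ≤ ∣ tabulate (does ∘ P?) ∣ · x
    sum≤count· {zero}  P? f≤x f≤0 = ≤-refl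
    sum≤count· {suc n} P? f≤x f≤0 with ih ← sum≤count· (P? ∘ suc) (f≤x ∘ suc) (f≤0 ∘ suc) | P? zero
    ... | yes p = +-mono-≤ (f≤x zero p) ih
    ... | no ¬p = ≤-respʳ-≈ (+-identityˡ _) (+-mono-≤ (f≤0 zero ¬p) ih)

  argmin : ∀ {p n} {P : Fin n → Set p} → (∀ j → Dec (P j)) → (g : Fin n → Carrier) →
           (∃[ j ] P j) → ∃[ m ] P m × (∀ i → P i → g m ≤ g i)
  argmin {n = suc n} {P} P? g (j , pj) with any? (P? ∘ suc) | P? zero
  ... | no none | _ = zero , first j pj , λ where
          zero    _  → ≤-refl
          (suc i) pi → contradiction (i , pi) none
    where
    first : ∀ j → P j → P zero
    first zero    p = p
    first (suc i) p = contradiction (i , p) none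
  ... | yes some | P0? with argmin (P? ∘ suc) (g ∘ suc) some
  ...   | m , pm , least with P0?
  ...     | no ¬p0 = suc m , pm , λ where
              zero    p0 → contradiction p0 ¬p0
              (suc i) pi → least i pi
  ...     | yes p0 with total (g zero) (g (suc m))
  ...       | inj₁ g0≤gm = zero , p0 , λ where
                zero    _  → ≤-refl
                (suc i) pi → ≤-trans g0≤gm (least i pi)
  ...       | inj₂ gm≤g0 = suc m , pm , λ where
                zero    _  → gm≤g0
                (suc i) pi → least i pi

  -- Yields the small threshold of the final count, below the remaining work of every unfinished
  -- job.
  positive-bound : ∀ {n} (x : Fin n → Carrier) →
                   ∃[ b ] 0# < b × (∀ j → 0# < x j → b ≤ x j)
  positive-bound {zero}  x = 1# , 0<1 , λ ()
  positive-bound {suc n} x with positive-bound (x ∘ suc) | 0# <? x zero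
  ... | b , 0<b , b≤x | no  x₀≯0 = b , 0<b , λ where
          zero    0<x₀ → contradiction 0<x₀ x₀≯0
          (suc j) 0<xⱼ → b≤x j 0<xⱼ
  ... | b , 0<b , b≤x | yes 0<x₀ = b ⊓ x zero , ⊓-pos 0<b 0<x₀ , λ where
          zero    _    → x⊓y≤y _ _
          (suc j) 0<xⱼ → ≤-trans (x⊓y≤x _ _) (b≤x j 0<xⱼ)

  -- `q` counts the entries that the cap c cuts off, and `r` is the sum of the others. Raising the
  -- cap to d lets only those `q` entries grow, each to at most d.
  sum-⊓-split : ∀ {n} (y : Fin n → Carrier) {c d} → c ≤ d → (∀ j → 0# ≤ y j) →
                ∃[ q ] ∃[ r ] 0# ≤ r × sum (λ j → y j ⊓ c) ≈ q · c + r ×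
                              sum (λ j → y j ⊓ d) ≤ q · d + r
  sum-⊓-split {zero}  y c≤d 0≤y =
    0 , 0# , ≤-refl , ≈-sym (+-identityˡ 0#) , ≤-reflexive (≈-sym (+-identityˡ 0#))
  sum-⊓-split {suc n} y {c} {d} c≤d 0≤y
    with sum-⊓-split (y ∘ suc) c≤d (0≤y ∘ suc) | total c (y zero)
  ... | q , r , 0≤r , eq , le | inj₁ c≤y₀ = suc q , r , 0≤r ,
    ≈-trans (+-cong (x≤y⇒y⊓x≈x c≤y₀) eq) (≈-sym (+-assoc c _ _)) ,
    ≤-respʳ-≈ (≈-sym (+-assoc d _ _)) (+-mono-≤ (x⊓y≤y _ _) le)
  ... | q , r , 0≤r , eq , le | inj₂ y₀≤c = q , y zero + r , +-nonneg (0≤y zero) 0≤r ,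
    ≈-trans (+-cong (x≤y⇒x⊓y≈x y₀≤c) eq) (swap (y zero) (q · c) r) ,
    ≤-respʳ-≈ (swap (y zero) (q · d) r) (+-mono-≤ (x⊓y≤x _ _) le)
    where
    swap : ∀ a b c → a + (b + c) ≈ b + (a + c)
    swap = solve 3 (λ a b c → a :+ (b :+ c) := b :+ (a :+ c)) ≈-refl

  -- Entries that vanish or reach λ₀ have no value strictly between, so the number `a` of full
  -- entries is the same for every θ up to λ₀.
  sum-⊓-count : ∀ {n} (z : Fin n → Carrier) {λ₀} → (∀ j → z j ≈ 0# ⊎ λ₀ ≤ z j) →
                ∃[ a ] (∀ {θ} → 0# ≤ θ → θ ≤ λ₀ → sum (λ j → z j ⊓ θ) ≈ a · θ)
  sum-⊓-count {zero}  z z∈ = 0 , λ _ _ → ≈-refl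
  sum-⊓-count {suc n} z z∈ with sum-⊓-count (z ∘ suc) (z∈ ∘ suc) | z∈ zero
  ... | a , eq | inj₁ z₀≈0 = a , λ 0≤θ θ≤λ → ≈-trans
    (+-cong (≈-trans (x≤y⇒x⊓y≈x (≤-respˡ-≈ (≈-sym z₀≈0) 0≤θ)) z₀≈0) (eq 0≤θ θ≤λ))
    (+-identityˡ _)
  ... | a , eq | inj₂ λ≤z₀ = suc a , λ 0≤θ θ≤λ →
    +-cong (x≤y⇒y⊓x≈x (≤-trans θ≤λ λ≤z₀)) (eq 0≤θ θ≤λ)

  sum-⊓-count-but-one : ∀ {n} (z : Fin n → Carrier) {λ₀} (k : Fin n) →
    (∀ j → j ≢ k → z j ≈ 0# ⊎ λ₀ ≤ z j) →
    ∃[ a ] (∀ {θ} → 0# ≤ θ → θ ≤ λ₀ → sum (λ j → z j ⊓ θ) ≈ z k ⊓ θ + a · θ)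
  sum-⊓-count-but-one {suc n} z k z∈
    with sum-⊓-count (removeAt z k) (λ j → z∈ (punchIn k j) (punchInᵢ≢i k j))
  ... | a , count = a , λ {θ} 0≤θ θ≤λ →
    ≈-trans (sum-remove {i = k} (λ j → z j ⊓ θ)) (+-congˡ (count 0≤θ θ≤λ))

  -- With q = #{ j : N θ ≤ y j }, either q N exceeds the number of full entries
  -- of x, or the entries of y below N θ compensate for the missing ones.  That
  -- N is an integer is used to separate the two cases.
  truncated-sum-≤ : ∀ {n} (x y : Fin n → Carrier) (N : ℕ) {θ λ₀} → 0# ≤ θ → θ ≤ λ₀ →
    (∀ j → 0# ≤ y j) → (k : Fin n) → (∀ j → j ≢ k → x j ≈ 0# ⊎ λ₀ ≤ x j) →
    sum (λ j → x j ⊓ λ₀) ≤ sum (λ j → y j ⊓ N · λ₀) →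
    sum (λ j → x j ⊓ θ) ≤ sum (λ j → y j ⊓ N · θ)
  truncated-sum-≤ x y N {θ} {λ₀} 0≤θ θ≤λ 0≤y k x∈ Σ≤
    with sum-⊓-count-but-one x k x∈ | sum-⊓-split y (·-monoʳ-≤ N θ≤λ) 0≤y
  ... | a , count | q , r , 0≤r , split , Σ≤split with suc a ℕ.≤? q *ℕ N
  ...   | yes a<qN = begin
    sum (λ j → x j ⊓ θ)     ≈⟨ count 0≤θ θ≤λ ⟩
    x k ⊓ θ + a · θ         ≤⟨ +-monoˡ-≤ (a · θ) (x⊓y≤y (x k) θ) ⟩
    suc a · θ               ≤⟨ ·-monoˡ-≤ 0≤θ a<qN ⟩
    (q *ℕ N) · θ            ≈⟨ ·-assocˡ θ q N ⟨
    q · (N · θ)             ≈⟨ +-identityʳ _ ⟨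
    q · (N · θ) + 0#        ≤⟨ +-mono-≤ ≤-refl 0≤r ⟩
    q · (N · θ) + r         ≈⟨ split ⟨
    sum (λ j → y j ⊓ N · θ) ∎
    where open ≤-Reasoning
  ...   | no a≮qN = begin
    sum (λ j → x j ⊓ θ)               ≈⟨ count 0≤θ θ≤λ ⟩
    x k ⊓ θ + a · θ                   ≈⟨ +-congˡ (a·≈ θ) ⟩
    x k ⊓ θ + (q · (N · θ) + b · θ)   ≤⟨ +-mono-≤ (⊓-monoʳ-≤ (x k) θ≤λ)
                                           (+-mono-≤ ≤-refl (·-monoʳ-≤ b θ≤λ)) ⟩
    x k ⊓ λ₀ + (q · (N · θ) + b · λ₀) ≤⟨ ≤-by rest≤r
                                           (shuffle (x k ⊓ λ₀) (q · (N · θ)) (b · λ₀) r) ⟩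
    q · (N · θ) + r                   ≈⟨ split ⟨
    sum (λ j → y j ⊓ N · θ)           ∎
    where
    open ≤-Reasoning
    qN≤a : q *ℕ N ≤ℕ a
    qN≤a = ℕ.≤-pred (ℕ.≰⇒> a≮qN)
    b : ℕ
    b = a ℕ.∸ q *ℕ N
    a·≈ : ∀ z → a · z ≈ q · (N · z) + b · z
    a·≈ z = ≈-trans (≈-reflexive (≡.cong (_· z) (≡.sym (ℕ.m+[n∸m]≡n qN≤a))))
      (≈-trans (·-homo-+ z (q *ℕ N) b) (+-congʳ (≈-sym (·-assocˡ z q N))))
    shuffle : ∀ x p b r → (x + (p + b)) + r ≈ (p + r) + (x + b)
    shuffle = solve 4 (λ x p b r → (x :+ (p :+ b)) :+ r := (p :+ r) :+ (x :+ b)) ≈-refl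
    -- At the cap λ₀ the terms q N λ₀ cancel on both sides. What is left bounds the excess of x by
    -- `r`; the excess only shrinks as λ₀ is lowered to θ, while `r` stays.
    rest≤r : x k ⊓ λ₀ + b · λ₀ ≤ r
    rest≤r = ≤-by
      (begin
        x k ⊓ λ₀ + (q · (N · λ₀) + b · λ₀) ≈⟨ +-congˡ (a·≈ λ₀) ⟨
        x k ⊓ λ₀ + a · λ₀                  ≈⟨ count (≤-trans 0≤θ θ≤λ) ≤-refl ⟨
        sum (λ j → x j ⊓ λ₀)               ≤⟨ Σ≤ ⟩
        sum (λ j → y j ⊓ N · λ₀)           ≤⟨ Σ≤split ⟩
        q · (N · λ₀) + r                   ∎)
      (solve 4 (λ x p b r → (x :+ b) :+ (p :+ r) := r :+ (x :+ (p :+ b))) ≈-refl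
        (x k ⊓ λ₀) (q · (N · λ₀)) (b · λ₀) r)

-- Basic properties of arbitrary schedules

module ScheduleProperties {c ℓ₁ ℓ₂} (F : ArchimedeanOrderedField c ℓ₁ ℓ₂) where
  open ArchimedeanOrderedField F
  open OrderedField F
  open Sums F
  open Scheduling F

  module _ {I : Instance} (S : Schedule I) where
    open Instance I
    open Schedule S

    e-cong : ∀ j {s t} → s ≈ t → e j s ≈ e j t
    e-cong j s≈t = antisym (e-mono j (≤-reflexive s≈t)) (e-mono j (≤-reflexive (≈-sym s≈t)))

    e-nonneg : ∀ j t → 0# ≤ e j t
    e-nonneg j t with total t (release j)
    ... | inj₁ t≤r = ≤-reflexive (≈-sym (e-before-release j t≤r))
    ... | inj₂ r≤t = ≤-trans (≤-reflexive (≈-sym (e-before-release j ≤-refl))) (e-mono j r≤t)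

    x-e-before-release : ∀ j {t} → t ≤ release j → ∀ x → x - e j t ≈ x
    x-e-before-release j t≤r x = ≈-trans (+-congˡ (-‿cong (e-before-release j t≤r))) (x-0≈x x)

    completed⇒remaining≈0 : ∀ {j t} → e j t ≈ size j → remaining j t ≈ 0#
    completed⇒remaining≈0 e≈size = ≈-trans (+-congˡ (-‿cong e≈size)) (-‿inverseʳ _)

    inactive⇒completed : ∀ {j t} → release j ≤ t → ¬ Active j t → e j t ≈ size j
    inactive⇒completed {j} {t} r≤t inactive =
      antisym (e≤size j t) (≮⇒≥ λ e<size → inactive (r≤t , e<size))

    active-at-release : ∀ j → Active j (release j)
    active-at-release j =
      ≤-refl , ≤-<-trans (≤-reflexive (e-before-release j ≤-refl)) (size>0 j)

    remaining>0 : ∀ {j t} → Active j t → 0# < remaining j t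
    remaining>0 (_ , e<size) = x<y⇒0<y-x e<size

  module _ (I : Instance) where
    open Instance I

    -- Before its release a job is treated as having size 0. It then contributes nothing to either
    -- side, and all sums can range over the whole set of jobs.
    available : Carrier → Job → Carrier
    available t j = if does (release j ≤? t) then size j else 0#

    available-released : ∀ {t j} → release j ≤ t → available t j ≡ size j
    available-released {t} {j} r≤t with release j ≤? t
    ... | yes _   = ≡.refl
    ... | no  r≰t = contradiction r≤t r≰t

    available-unreleased : ∀ {t j} → ¬ release j ≤ t → available t j ≡ 0#
    available-unreleased {t} {j} r≰t with release j ≤? t
    ... | yes r≤t = contradiction r≤t r≰t
    ... | no  _   = ≡.refl

  module _ {I : Instance} (S : Schedule I) where
    open Instance I
    open Schedule S

    available-remaining-nonneg : ∀ {t u} j → (¬ release j ≤ t → u ≤ release j) →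
                                 0# ≤ available I t j - e j u
    available-remaining-nonneg {t} {u} j late with release j ≤? t
    ... | yes _   = x≤y⇒0≤y-x (e≤size j u)
    ... | no  r≰t = ≤-reflexive (≈-sym (x-e-before-release S j (late r≰t) 0#))

module Algorithm {c ℓ₁ ℓ₂} (F : ArchimedeanOrderedField c ℓ₁ ℓ₂) where
  open ArchimedeanOrderedField F
  open OrderedField F
  open Sums F
  open Scheduling F
  open ScheduleProperties F

  -- The potential of a single job

  module Potential (ε : Carrier) (0<ε : 0# < ε) (ε<1 : ε < 1#) where

    κ : Carrier
    κ = ε * (1# - ε) ⁻¹

    private
      0<1-ε : 0# < 1# - ε
      0<1-ε = x<y⇒0<y-x ε<1

    0<κ : 0# < κ
    0<κ = *-pos 0<ε (⁻¹-pos 0<1-ε)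

    -- Because κ (1 - ε) = ε. A job of size x becomes known on having received x - ε x; there both
    -- formulas for its estimate give ε x. The conversions below translate between the two sides of
    -- this crossing point.
    κ[x-εx]≈εx : ∀ x → κ * (x - ε * x) ≈ ε * x
    κ[x-εx]≈εx x = begin-equality
      κ * (x - ε * x)                    ≈⟨ *-congˡ (+-congʳ (*-identityˡ x)) ⟨
      κ * (1# * x - ε * x)               ≈⟨ regroup ((1# - ε) ⁻¹) 1# ⟩
      ε * ((1# - ε) * ((1# - ε) ⁻¹ * x)) ≈⟨ *-congˡ (*-⁻¹-cancelˡ 0<1-ε x) ⟩
      ε * x                              ∎
      where
      open ≤-Reasoning
      regroup : ∀ w o → ε * w * (o * x - ε * x) ≈ ε * ((o - ε) * (w * x))
      regroup w o = solve 4 (λ ε w o x →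
        ε :* w :* (o :* x :- ε :* x) := ε :* ((o :- ε) :* (w :* x))) ≈-refl ε w o x

    e≤x-εx⇒κe≤εx : ∀ {e x} → e ≤ x - ε * x → κ * e ≤ ε * x
    e≤x-εx⇒κe≤εx le = ≤-respʳ-≈ (κ[x-εx]≈εx _) (*-monoʳ-≤ (<⇒≤ 0<κ) le)

    x-εx≤e⇒εx≤κe : ∀ {e x} → x - ε * x ≤ e → ε * x ≤ κ * e
    x-εx≤e⇒εx≤κe le = ≤-respˡ-≈ (κ[x-εx]≈εx _) (*-monoʳ-≤ (<⇒≤ 0<κ) le)

    κe≤εx⇒e≤x-εx : ∀ {e x} → κ * e ≤ ε * x → e ≤ x - ε * x
    κe≤εx⇒e≤x-εx le = *-cancelˡ-≤ 0<κ (≤-respʳ-≈ (≈-sym (κ[x-εx]≈εx _)) le)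

    εx≤κe⇒x-εx≤e : ∀ {e x} → ε * x ≤ κ * e → x - ε * x ≤ e
    εx≤κe⇒x-εx≤e le = *-cancelˡ-≤ 0<κ (≤-respˡ-≈ (≈-sym (κ[x-εx]≈εx _)) le)

    p-e≤εp⇒εp≤κe : ∀ {p e} → p - e ≤ ε * p → ε * p ≤ κ * e
    p-e≤εp⇒εp≤κe {p} {e} le = x-εx≤e⇒εx≤κe (≤-by le
      (solve 3 (λ p e q → (p :- q) :+ q := e :+ (p :- e)) ≈-refl p e (ε * p)))

    εp≤κe⇒p-e≤εp : ∀ {p e} → ε * p ≤ κ * e → p - e ≤ ε * p
    εp≤κe⇒p-e≤εp {p} {e} le = ≤-by (εx≤κe⇒x-εx≤e le)
      (solve 3 (λ p e q → (p :- e) :+ e := q :+ (p :- q)) ≈-refl p e (ε * p))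

    κe≤εp⇒εp≤p-e : ∀ {p e} → κ * e ≤ ε * p → ε * p ≤ p - e
    κe≤εp⇒εp≤p-e {p} {e} le = ≤-by (κe≤εx⇒e≤x-εx le)
      (solve 3 (λ p e q → q :+ (p :- q) := (p :- e) :+ e) ≈-refl p e (ε * p))

    -- For a job of size p that has received e, the least function of θ = ε v
    -- above (p - e) ⊓ θ that decreases at unit rate in e as long as the estimate
    -- of the job is at most θ.
    potential : Carrier → Carrier → Carrier → Carrier
    potential v p e = (p ⊓ v - e) ⊔ ((p - e) ⊓ (ε * v))

    potential-cong : ∀ {v p e₁ e₂} → e₁ ≈ e₂ → potential v p e₁ ≈ potential v p e₂
    potential-cong e₁≈e₂ = ⊔-cong (+-congˡ (-‿cong e₁≈e₂)) (⊓-congʳ _ (+-congˡ (-‿cong e₁≈e₂)))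

    ⊓≤potential : ∀ v p e → (p - e) ⊓ (ε * v) ≤ potential v p e
    ⊓≤potential v p e = x≤y⊔x _ _

    -- Once κ e has reached ε v, at least v - ε v has been received. Then p ⊓ v - e lies below both
    -- p - e and ε v, so the maximum is just the truncated remaining work.
    potential-≤⊓ : ∀ {v p e} → ε * v ≤ κ * e → potential v p e ≤ (p - e) ⊓ (ε * v)
    potential-≤⊓ {v} {p} {e} εv≤κe = ⊔-lub (⊓-glb
      (+-monoˡ-≤ (- e) (x⊓y≤x p v))
      (≤-trans (+-monoˡ-≤ (- e) (x⊓y≤y p v)) (≤-by (εx≤κe⇒x-εx≤e εv≤κe)
        (solve 3 (λ v e q → (v :- e) :+ e := q :+ (v :- q)) ≈-refl v e (ε * v))))) ≤-refl

    potential-≤⊓-completed : ∀ {v p e} → 0# ≤ v → p - e ≈ 0# → potential v p e ≤ (p - e) ⊓ (ε * v)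
    potential-≤⊓-completed {v} {p} {e} 0≤v p-e≈0 = ⊔-lub (⊓-glb p⊓v-e≤p-e
      (≤-trans p⊓v-e≤p-e (≤-respˡ-≈ (≈-sym p-e≈0) (*-nonneg (<⇒≤ 0<ε) 0≤v)))) ≤-refl
      where p⊓v-e≤p-e = +-monoˡ-≤ (- e) (x⊓y≤x p v)

    potential-≤0 : ∀ {v p e} → p - e ≈ 0# → potential v p e ≤ 0#
    potential-≤0 {v} {p} {e} p-e≈0 = ≤-trans
      (⊔-lub (+-monoˡ-≤ (- e) (x⊓y≤x p v)) (x⊓y≤x (p - e) _)) (≤-reflexive p-e≈0)

    -- An untouched job has potential at most p ⊓ v, against p ⊓ N ε v in the other schedule. This
    -- comparison dictates the factor N.
    potential-initial : ∀ {v p e N y} → 0# ≤ v → v ≤ N · (ε * v) → e ≈ 0# → y ≈ p →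
                        potential v p e ≤ y ⊓ N · (ε * v)
    potential-initial {v} {p} {e} {N} {y} 0≤v v≤Nεv e≈0 y≈p = ⊔-lub
      (⊓-glb (≤-trans (≤-reflexive (-e≈ _)) (≤-trans (x⊓y≤x p v) p≤y))
             (≤-trans (≤-reflexive (-e≈ _)) (≤-trans (x⊓y≤y p v) v≤Nεv)))
      (⊓-glb (≤-trans (x⊓y≤x _ _) (≤-trans (≤-reflexive (-e≈ p)) p≤y))
             (≤-trans (x⊓y≤y _ _) (≤-trans εv≤v v≤Nεv)))
      where
      p≤y : p ≤ y
      p≤y = ≤-reflexive (≈-sym y≈p)
      -e≈ : ∀ x → x - e ≈ x
      -e≈ x = ≈-trans (+-congˡ (-‿cong e≈0)) (x-0≈x x)
      εv≤v : ε * v ≤ v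
      εv≤v = ≤-respˡ-≈ (*-comm v ε) (≤-respʳ-≈ (*-identityʳ v) (*-monoʳ-≤ 0≤v (<⇒≤ ε<1)))

    -- The first term of the maximum always falls at unit rate. The second does so too if its cap is
    -- inactive from the start (p - e₁ ≤ ε v); otherwise, adding the work to its final value must
    -- give at most the initial first term, which holds if e₂ ≤ v - ε v or p ≤ v. The alternatives
    -- match the three terms of `peak`.
    potential-drop : ∀ {v p e₁ e₂} → (p - e₁ ≤ ε * v ⊎ κ * e₂ ≤ ε * v ⊎ ε * p ≤ ε * v) →
                     potential v p e₂ + (e₂ - e₁) ≤ potential v p e₁
    potential-drop {v} {p} {e₁} {e₂} level≤ = 0≤y-x⇒x≤y (≤-respʳ-≈
        (solve 4 (λ f₁ f₂ e₁ e₂ → (f₁ :- (e₂ :- e₁)) :- f₂ := f₁ :- (f₂ :+ (e₂ :- e₁))) ≈-refl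
          f₁ (potential v p e₂) e₁ e₂)
        (x≤y⇒0≤y-x (⊔-lub (move first) (move (second level≤)))))
      where
      f₁ = potential v p e₁
      move : ∀ {x} → x + (e₂ - e₁) ≤ f₁ → x ≤ f₁ - (e₂ - e₁)
      move {x} le = ≤-by le
        (solve 3 (λ x d f → x :+ f := (f :- d) :+ (x :+ d)) ≈-refl x (e₂ - e₁) f₁)
      shift : ∀ x → x - e₂ + (e₂ - e₁) ≈ x - e₁
      shift x = solve 3 (λ x e₁ e₂ → x :- e₂ :+ (e₂ :- e₁) := x :- e₁) ≈-refl x e₁ e₂
      first : (p ⊓ v - e₂) + (e₂ - e₁) ≤ f₁
      first = ≤-respˡ-≈ (≈-sym (shift _)) (x≤x⊔y _ _)
      remaining : (p - e₂) ⊓ (ε * v) + (e₂ - e₁) ≤ p - e₁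
      remaining = ≤-respʳ-≈ (shift p) (+-monoˡ-≤ _ (x⊓y≤x _ _))
      first-≤ : (p - e₂) ⊓ (ε * v) + (e₂ - e₁) ≤ v - e₁ →
                (p - e₂) ⊓ (ε * v) + (e₂ - e₁) ≤ p ⊓ v - e₁
      first-≤ le = ≤-by (⊓-glb (add remaining) (add le))
        (solve 3 (λ x e m → x :+ m := (m :- e) :+ (x :+ e)) ≈-refl _ e₁ (p ⊓ v))
        where
        add : ∀ {x z} → x ≤ z - e₁ → x + e₁ ≤ z
        add {x} {z} le = ≤-by le (solve 3 (λ x e z → (x :+ e) :+ (z :- e) := z :+ x) ≈-refl x e₁ z)
      second : (p - e₁ ≤ ε * v ⊎ κ * e₂ ≤ ε * v ⊎ ε * p ≤ ε * v) →
               (p - e₂) ⊓ (ε * v) + (e₂ - e₁) ≤ f₁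
      second (inj₁ r≤) = ≤-trans (⊓-glb remaining (≤-trans remaining r≤)) (⊓≤potential v p e₁)
      second (inj₂ (inj₁ κe≤)) = ≤-trans (first-≤ (≤-by
        (+-mono-≤ (x⊓y≤y (p - e₂) (ε * v)) (κe≤εx⇒e≤x-εx κe≤))
        (solve 5 (λ m q v e₁ e₂ →
          (m :+ (e₂ :- e₁)) :+ (q :+ (v :- q)) := (v :- e₁) :+ (m :+ e₂))
          ≈-refl _ (ε * v) v e₁ e₂))) (x≤x⊔y _ _)
      second (inj₂ (inj₂ εp≤)) = ≤-trans (first-≤ (≤-trans remaining
        (+-monoˡ-≤ (- e₁) (*-cancelˡ-≤ 0<ε εp≤)))) (x≤x⊔y _ _)

  -- Estimates and the jobs chosen by SLF

  module Rules (ε : Carrier) (0<ε : 0# < ε) (ε<1 : ε < 1#) {I : Instance} (X : Schedule I) where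
    open Instance I
    open Schedule X hiding (activeSet; totalFlowTime)

    open Potential ε 0<ε ε<1

    η-cases : ∀ j t → (remaining j t ≤ ε * size j × η ε X j t ≡ remaining j t) ⊎
                      (¬ remaining j t ≤ ε * size j × η ε X j t ≡ κ * e j t)
    η-cases j t with remaining j t ≤? ε * size j
    ... | yes r≤εp = inj₁ (r≤εp , ≡.refl)
    ... | no r≰εp = inj₂ (r≰εp , ≡.refl)

    unknown⇒κe≤εp : ∀ {j t} → ¬ remaining j t ≤ ε * size j → κ * e j t ≤ ε * size j
    unknown⇒κe≤εp r≰εp = ≮⇒≥ λ εp<κe → r≰εp (εp≤κe⇒p-e≤εp (<⇒≤ εp<κe))

    -- With `η≤κe` and `η-glb`, this makes the estimate the minimum of remaining work and κ e: the
    -- two cross exactly where a job becomes known.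
    η≤remaining : ∀ j t → η ε X j t ≤ remaining j t
    η≤remaining j t with η-cases j t
    ... | inj₁ (_ , η≡r)        = ≤-reflexive (≈-reflexive η≡r)
    ... | inj₂ (r≰εp , η≡κe) = ≤-trans (≤-reflexive (≈-reflexive η≡κe))
      (≤-trans (unknown⇒κe≤εp r≰εp) (<⇒≤ (≰⇒> r≰εp)))

    η≤κe : ∀ j t → η ε X j t ≤ κ * e j t
    η≤κe j t with η-cases j t
    ... | inj₁ (r≤εp , η≡r) = ≤-trans (≤-reflexive (≈-reflexive η≡r))
      (≤-trans r≤εp (p-e≤εp⇒εp≤κe r≤εp))
    ... | inj₂ (_ , η≡κe)    = ≤-reflexive (≈-reflexive η≡κe)

    η-glb : ∀ {z j t} → z ≤ remaining j t → z ≤ κ * e j t → z ≤ η ε X j t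
    η-glb {z} {j} {t} z≤r z≤κe with η-cases j t
    ... | inj₁ (_ , η≡r)  = ≤-respʳ-≈ (≈-reflexive (≡.sym η≡r)) z≤r
    ... | inj₂ (_ , η≡κe) = ≤-respʳ-≈ (≈-reflexive (≡.sym η≡κe)) z≤κe

    -- The case distinctions at s and t are made separately, so the branches cannot be matched
    -- directly; the description of η as a minimum avoids comparing them.
    η-mono-e : ∀ {j s t} → e j s ≈ e j t → η ε X j s ≤ η ε X j t
    η-mono-e {j} {s} {t} es≈et = η-glb
      (≤-trans (η≤remaining j s) (≤-reflexive (+-congˡ (-‿cong es≈et))))
      (≤-trans (η≤κe j s) (≤-reflexive (*-congˡ es≈et)))

    -- A common form of both rules, with no distinction between known and unknown. The analysis of
    -- phases needs the rules only through this notion, `busy` and `known-processed-alone`.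
    Leader : Job → Carrier → Set _
    Leader k t = Active k t × (∀ i → Active i t → η ε X k t ≤ η ε X i t)

    leader-exists : ∀ {t} → (∃[ j ] Active j t) → ∃[ m ] Leader m t
    leader-exists {t} = argmin (λ j → active? j t) (λ j → η ε X j t)

    firstRule⇒leader : ∀ {k t} → FirstRule ε X k t → Leader k t
    firstRule⇒leader {k} {t} (((active , _) , min-known) , min-unknown) = active , λ i aᵢ →
      case remaining i t ≤? ε * size i of λ where
        (yes r≤εp)  → min-known i (aᵢ , r≤εp)
        (no r≰εp) → min-unknown i (aᵢ , r≰εp)

    -- A known leader would satisfy the first rule.
    leader⇒minUnknown : ∀ {m t} → Leader m t → ¬ (∃[ k ] FirstRule ε X k t) → MinUnknown ε X m t
    leader⇒minUnknown {m} {t} (active , least) ¬first = (active , λ r≤εp → ¬first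
      (m , ((active , r≤εp) , λ i → least i ∘ proj₁) , λ i → least i ∘ proj₁)) ,
      λ i → least i ∘ proj₁

    busy : ∀ {t A i} → Processes ε X t A → Active i t → Nonempty A
    busy (idle inactive) aᵢ = contradiction aᵢ (inactive _)
    busy (known k _) _ = k , x∈⁅x⁆ k
    busy (unknown A some ¬first A⇔) _ with leader-exists some
    ... | m , leader = m , Equivalence.from (A⇔ m) (leader⇒minUnknown leader ¬first)

    processed⇒leader : ∀ {t A k} → Processes ε X t A → k ∈ A → Leader k t
    processed⇒leader (idle _) k∈∅ = contradiction k∈∅ ∉⊥
    processed⇒leader {t} (known k first) k∈ =
      ≡.subst (λ i → Leader i t) (≡.sym (x∈⁅y⁆⇒x≡y k k∈)) (firstRule⇒leader first)
    -- The first rule fails, so the overall leader m is itself unknown, and a minimum over the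
    -- unknown jobs is a minimum over all active ones.
    processed⇒leader {k = k} (unknown A some ¬first A⇔) k∈A
      with leader-exists some | Equivalence.to (A⇔ k) k∈A
    ... | m , leader@(_ , least) | (active , _) , min-unknown =
      active , λ i aᵢ → ≤-trans
        (min-unknown m (proj₁ (leader⇒minUnknown leader ¬first))) (least i aᵢ)

    known-processed-alone : ∀ {t A k} → Processes ε X t A → k ∈ A →
                            remaining k t ≤ ε * size k → ∀ {i} → i ∈ A → i ≡ k
    known-processed-alone (idle _) k∈∅ _ _ = contradiction k∈∅ ∉⊥
    known-processed-alone (known k _) k∈ _ i∈ = ≡.trans (x∈⁅y⁆⇒x≡y k i∈) (≡.sym (x∈⁅y⁆⇒x≡y k k∈))
    known-processed-alone {k = k} (unknown A _ _ A⇔) k∈A r≤εp _ =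
      contradiction r≤εp (proj₂ (proj₁ (Equivalence.to (A⇔ k) k∈A)))

    -- A phase in which some job is processed

    module BusyPhase {t u A} (t<u : t < u) (phase : Phase ε X t u A) {k : Job} (k∈A : k ∈ A) where
      open Phase phase

      private
        0<∣A∣ : 0 ℕ.< ∣ A ∣
        0<∣A∣ = ℕ.≤-<-trans ℕ.z≤n (x∈p⇒∣p-x∣<∣p∣ k∈A)

      -- A job arriving strictly inside the phase has estimate at most 0 at that moment. The
      -- processed job k would have to match it, but k is unfinished and has received work since t,
      -- so its estimate is positive.
      released-early : ∀ {i} → ¬ release i ≤ t → u ≤ release i
      released-early {i} r≰t = ≮⇒≥ λ s<u →
        let s     = release i
            t<s   = ≰⇒> r≰t
            t≤s   = <⇒≤ t<s
            (active-k , least) = processed⇒leader (chosen t≤s s<u) k∈A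
            η≤0 : η ε X k s ≤ 0#
            η≤0 = ≤-trans (least i (active-at-release X i)) (≤-trans (η≤κe i s)
              (≤-reflexive (≈-trans (*-congˡ (e-before-release i ≤-refl)) (zeroʳ _))))
            et<es : e k t < e k s
            et<es = ≰⇒> λ es≤et → <⇒≱ t<s (≤-by
              (≤-respˡ-≈ (served t≤s (<⇒≤ s<u) k k∈A) (≤-respʳ-≈ (served ≤-refl (<⇒≤ t<u) k k∈A)
                (·-monoʳ-≤ ∣ A ∣ (+-monoˡ-≤ (- e k t) es≤et))))
              (solve 2 (λ s t → s :+ (t :- t) := t :+ (s :- t)) ≈-refl s t))
        in case η-cases k s of λ where
          (inj₁ (_ , η≡r))  → <⇒≱ (remaining>0 X active-k) (≤-respˡ-≈ (≈-reflexive η≡r) η≤0)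
          (inj₂ (_ , η≡κe)) → <⇒≱ (*-pos (0<κ) (≤-<-trans (e-nonneg X k t) et<es))
                                  (≤-respˡ-≈ (≈-reflexive η≡κe) η≤0)

      -- The rate is constantly 1 / ∣ A ∣, so the time is found by solving a linear equation.
      intermediate-value : ∀ {j E} → j ∈ A → e j t ≤ E → E < e j u →
                           ∃[ s ] t ≤ s × s < u × e j s ≈ E
      intermediate-value {j} {E} j∈A et≤E E<eu = s , t≤s , s<u , es≈E
        where
        s : Carrier
        s = t + ∣ A ∣ · (E - e j t)
        t≤s : t ≤ s
        t≤s = ≤-respˡ-≈ (+-identityʳ t) (+-mono-≤ ≤-refl (·-nonneg ∣ A ∣ (x≤y⇒0≤y-x et≤E)))
        s<u : s < u
        s<u = <-by (<-≤-trans (·-monoʳ-< 0<∣A∣ {E - e j t} {e j u - e j t} (<-by E<eu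
                (solve 3 (λ E t u → (E :- t) :+ u := (u :- t) :+ E) ≈-refl E (e j t) (e j u))))
                (≤-reflexive (served (<⇒≤ t<u) ≤-refl j j∈A)))
              (solve 3 (λ t x u → (t :+ x) :+ (u :- t) := u :+ x) ≈-refl t (∣ A ∣ · (E - e j t)) u)
        es≈E : e j s ≈ E
        es≈E = ≈-trans (solve 2 (λ s t → s := (s :- t) :+ t) ≈-refl (e j s) (e j t))
          (≈-trans (+-congʳ (·-cancelˡ 0<∣A∣ (≈-trans (served t≤s (<⇒≤ s<u) j j∈A)
                     (solve 2 (λ t x → (t :+ x) :- t := x) ≈-refl t (∣ A ∣ · (E - e j t))))))
                   (solve 2 (λ E t → (E :- t) :+ t := E) ≈-refl E (e j t)))

      -- The maximum over [t , u] of the estimate min (remaining , κ e) of job k.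
      peak : Carrier
      peak = (remaining k t ⊓ (κ * e k u)) ⊓ (ε * size k)

      peak≤r : peak ≤ remaining k t
      peak≤r = ≤-trans (x⊓y≤x _ _) (x⊓y≤x _ _)

      peak≤κe : peak ≤ κ * e k u
      peak≤κe = ≤-trans (x⊓y≤x _ _) (x⊓y≤y _ _)

      peak≤εp : peak ≤ ε * size k
      peak≤εp = x⊓y≤y _ _

      -- The estimate of i stays constant while i waits. If it were below `peak`, then k, being a
      -- leader at t, would start at or below it and be unknown; its estimate would rise past that
      -- of i within the phase, so that k would no longer lead.
      peak≤η-waiting : ∀ {i} → i ∉ A → Active i t → peak ≤ η ε X i t
      peak≤η-waiting {i} i∉A active-i@(r≤t , e<p) = ≮⇒≥ λ η<peak →
        let (_ , least) = processed⇒leader (chosen ≤-refl t<u) k∈A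
        in case η-cases k t of λ where
          (inj₁ (_ , η≡r))  → <⇒≱ η<peak (≤-trans peak≤r
            (≤-trans (≤-reflexive (≈-reflexive (≡.sym η≡r))) (least i active-i)))
          (inj₂ (_ , η≡κe)) → overtaken η<peak
            (≤-trans (≤-reflexive (≈-reflexive (≡.sym η≡κe))) (least i active-i))
        where
        overtaken : η ε X i t < peak → ¬ κ * e k t ≤ η ε X i t
        overtaken η<peak κe≤η =
          -- A value strictly below `peak` is reached strictly before u, where A is still a choice
          -- of SLF, and while k is still unknown.
          let (z , η<z , z<peak) = dense η<peak
              E = κ ⁻¹ * z
              κE≈z = *-⁻¹-cancelˡ (0<κ) z
              (s , t≤s , s<u , es≈E) = intermediate-value k∈A
                (*-cancelˡ-≤ (0<κ) (≤-respʳ-≈ (≈-sym κE≈z) (≤-trans κe≤η (<⇒≤ η<z))))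
                (≰⇒> λ eu≤E → <⇒≱ z<peak (≤-trans peak≤κe
                  (≤-respʳ-≈ κE≈z (*-monoʳ-≤ (<⇒≤ (0<κ)) eu≤E))))
              κes≈z = ≈-trans (*-congˡ es≈E) κE≈z
              es≈et = waiting t≤s (<⇒≤ s<u) i i∉A
              (_ , least) = processed⇒leader (chosen t≤s s<u) k∈A
              ηk≤ηi = ≤-trans
                (least i (≤-trans r≤t t≤s , ≤-<-trans (≤-reflexive es≈et) e<p)) (η-mono-e es≈et)
          in case η-cases k s of λ where
            (inj₁ (r≤εp , _)) → <⇒≱ z<peak (≤-trans peak≤εp
              (≤-respʳ-≈ κes≈z (p-e≤εp⇒εp≤κe r≤εp)))
            (inj₂ (_ , η≡κe))  → <⇒≱ η<z
              (≤-respˡ-≈ (≈-trans (≈-reflexive η≡κe) κes≈z) ηk≤ηi)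

      -- A known job is processed alone. If κ e exceeded ε p at u, the job would have become known
      -- at an earlier time of the phase; only at u itself may equality hold.
      shared⇒unknown : ∀ {i j} → i ∈ A → j ∈ A → j ≢ i →
                       ¬ remaining i t ≤ ε * size i × κ * e i u ≤ ε * size i
      shared⇒unknown {i} {j} i∈A j∈A j≢i = unknown-t , ≮⇒≥ λ εp<κe →
        let (s , t≤s , s<u , es≈E) = intermediate-value i∈A
              (κe≤εx⇒e≤x-εx (unknown⇒κe≤εp unknown-t))
              (≰⇒> λ eu≤E → <⇒≱ εp<κe (e≤x-εx⇒κe≤εx eu≤E))
        in j≢i (known-processed-alone (chosen t≤s s<u) i∈A (εp≤κe⇒p-e≤εp
             (x-εx≤e⇒εx≤κe (≤-reflexive (≈-sym es≈E)))) j∈A)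
        where
        unknown-t : ¬ remaining i t ≤ ε * size i
        unknown-t r≤εp = j≢i (known-processed-alone (chosen ≤-refl t<u) i∈A r≤εp j∈A)

      served-equally : ∀ {i j} → i ∈ A → j ∈ A → e i u - e i t ≈ e j u - e j t
      served-equally i∈A j∈A = ·-cancelˡ 0<∣A∣ (≈-trans (served (<⇒≤ t<u) ≤-refl _ i∈A)
                                               (≈-sym (served (<⇒≤ t<u) ≤-refl _ j∈A)))

      -- Both jobs lead at t and are unknown, so they have received equal work by then, and equal
      -- service preserves the tie.
      tied : ∀ {j} → j ∈ A → j ≢ k → e j u ≈ e k u
      tied {j} j∈A j≢k = antisym
        (behind k∈A j∈A (≢-sym j≢k) j≢k) (behind j∈A k∈A j≢k (≢-sym j≢k))
        where
        behind : ∀ {i j} → i ∈ A → j ∈ A → i ≢ j → j ≢ i → e j u ≤ e i u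
        behind {i} {j} i∈A j∈A i≢j j≢i = ≤-by
          (+-mono-≤ ej≤ei (≤-reflexive (served-equally j∈A i∈A)))
          (solve 4 (λ jt ju it iu → ju :+ (it :+ (iu :- it)) := iu :+ (jt :+ (ju :- jt))) ≈-refl
            (e j t) (e j u) (e i t) (e i u))
          where
          ej≤ei : e j t ≤ e i t
          ej≤ei = *-cancelˡ-≤ (0<κ) (case η-cases j t of λ where
            (inj₁ (r≤εp , _)) → contradiction r≤εp (proj₁ (shared⇒unknown j∈A i∈A i≢j))
            (inj₂ (_ , η≡κe))  → ≤-trans (≤-reflexive (≈-reflexive (≡.sym η≡κe)))
              (≤-trans (proj₂ (processed⇒leader (chosen ≤-refl t<u) j∈A) i
                              (proj₁ (processed⇒leader (chosen ≤-refl t<u) i∈A)))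
                       (η≤κe i t)))

      κe≤peak-tied : ∀ {j} → j ∈ A → j ≢ k → κ * e j u ≤ peak
      κe≤peak-tied j∈A j≢k = ≤-respˡ-≈ (*-congˡ (≈-sym (tied j∈A j≢k)))
        (let (unknown-k , κe≤εp) = shared⇒unknown k∈A j∈A j≢k
         in ⊓-glb (⊓-glb (≤-trans κe≤εp (<⇒≤ (≰⇒> unknown-k))) ≤-refl) κe≤εp)

      -- A processed job is tied with k and not yet past the point of becoming known, so its
      -- remaining work is at least κ e. A waiting active job keeps its estimate, which is at least
      -- `peak`. Job k is the exception: if processed as a known job, it may end below `peak`.
      above-peak : ∀ {j} → j ≢ k → release j ≤ t →
                   e j u ≈ size j ⊎ (peak ≤ remaining j u × peak ≤ κ * e j u)
      above-peak {j} j≢k r≤t with j ∈? A | active? j t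
      ... | yes j∈A | _ = inj₂ (≤-trans peak≤κeⱼ (≤-trans κe≤εp (κe≤εp⇒εp≤p-e κe≤εp)) , peak≤κeⱼ)
        where
        peak≤κeⱼ : peak ≤ κ * e j u
        peak≤κeⱼ = ≤-respʳ-≈ (*-congˡ (≈-sym (tied j∈A j≢k))) peak≤κe
        κe≤εp : κ * e j u ≤ ε * size j
        κe≤εp = proj₂ (shared⇒unknown j∈A k∈A (j≢k ∘ ≡.sym))
      ... | no j∉A | no inactive = inj₁ (≈-trans (waiting (<⇒≤ t<u) ≤-refl j j∉A)
                                                 (inactive⇒completed X r≤t inactive))
      ... | no j∉A | yes active  = inj₂
        (≤-trans peak≤η (≤-trans (η≤remaining j t) (≤-reflexive (+-congˡ (-‿cong et≈eu)))) ,
         ≤-trans peak≤η (≤-trans (η≤κe j t) (≤-reflexive (*-congˡ et≈eu))))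
        where
        peak≤η = peak≤η-waiting j∉A active
        et≈eu = ≈-sym (waiting (<⇒≤ t<u) ≤-refl j j∉A)

      total-service : sum (λ j → e j u - e j t) ≈ u - t
      total-service = ≈-trans
        (sum-supported A (λ j j∈A → served-equally j∈A k∈A)
          (λ j j∉A → ≈-trans (+-congʳ (waiting (<⇒≤ t<u) ≤-refl j j∉A)) (-‿inverseʳ _)))
        (served (<⇒≤ t<u) ≤-refl k k∈A)

  -- The inequality between SLF and an arbitrary schedule

  module Competitiveness (ε : Carrier) (0<ε : 0# < ε) (ε<1 : ε < 1#)
                         {I : Instance} (X S : Schedule I) where
    open Potential ε 0<ε ε<1
    open Rules ε 0<ε ε<1 X
    open Instance I
    private
      module X = Schedule X
      module S = Schedule S

    N : ℕ
    N = ⌈ ε ⁻¹ ⌉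

    -- The jobs released up to time t, compared by their work up to time u.
    DominatedAt : Carrier → Carrier → Set _
    DominatedAt t u = ∀ {v} → 0# ≤ v →
      sum (λ j → potential v (available I t j) (X.e j u)) ≤
      sum (λ j → (available I t j - S.e j u) ⊓ N · (ε * v))

    private
      0≤εv : ∀ {v} → 0# ≤ v → 0# ≤ ε * v
      0≤εv = *-nonneg (<⇒≤ 0<ε)

      -- The termwise hypothesis is f′ - f ≤ g′ - g, written without subtraction: the left side
      -- gains no more than the right.
      transfer : ∀ {n} {f g f′ g′ : Fin n → Carrier} → (∀ j → f′ j + g j ≤ f j + g′ j) →
                 sum f ≤ sum g → sum f′ ≤ sum g′
      transfer {f = f} {g} {f′} {g′} le Σf≤Σg = ≤-by
        (+-mono-≤ (≤-respˡ-≈ (∑-distrib-+ f′ g) (≤-respʳ-≈ (∑-distrib-+ f g′) (sum-mono-≤ le)))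
                  Σf≤Σg)
        (solve 4 (λ f g f′ g′ → f′ :+ ((f :+ g′) :+ g) := g′ :+ ((f′ :+ g) :+ f)) ≈-refl
          (sum f) (sum g) (sum f′) (sum g′))

    dominated-start : ∀ {t} → t ≤ 0# → DominatedAt t t
    dominated-start {t} t≤0 0≤v = sum-mono-≤ λ j →
      let t≤r = ≤-trans t≤0 (release≥0 j)
      in potential-initial {N = N} 0≤v (x≤⌈z⁻¹⌉·zx 0<ε 0≤v) (X.e-before-release j t≤r)
           (x-e-before-release S j t≤r _)

    module _ {t u} (t<u : t < u) (late : ∀ {j} → ¬ release j ≤ t → u ≤ release j) where

      dominated-arrivals : DominatedAt t u → DominatedAt u u
      dominated-arrivals dominated {v} 0≤v = transfer arrival (dominated 0≤v)
        where
        arrival : ∀ j →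
          potential v (available I u j) (X.e j u) + (available I t j - S.e j u) ⊓ N · (ε * v) ≤
          potential v (available I t j) (X.e j u) + (available I u j - S.e j u) ⊓ N · (ε * v)
        arrival j with release j ≤? t
        ... | yes r≤t rewrite available-released I {u} {j} (≤-trans r≤t (<⇒≤ t<u)) = ≤-refl
        -- Covers jobs released exactly at u as well as those still to come: `potential-initial`
        -- applies to either value of `available I u j`, and the old terms compare through 0.
        ... | no  r≰t = ≤-trans
          (+-mono-≤
            (potential-initial {N = N} 0≤v (x≤⌈z⁻¹⌉·zx 0<ε 0≤v) (X.e-before-release j (late r≰t))
              (x-e-before-release S j (late r≰t) _))
            (≤-trans (x⊓y≤x _ _) (≤-reflexive (x-e-before-release S j (late r≰t) 0#))))
          (≤-trans (≤-reflexive (+-comm _ _)) (+-monoˡ-≤ _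
            (≤-trans
              (⊓-glb (≤-reflexive (≈-sym (x-e-before-release X j (late r≰t) 0#))) (0≤εv 0≤v))
              (⊓≤potential v 0# (X.e j u)))))

      dominated-idle : (∀ j → release j ≤ t → X.e j u ≈ size j) → DominatedAt t u
      dominated-idle completed {v} 0≤v = sum-mono-≤ λ j → ≤-trans (potential-≤0 (finished j))
        (⊓-glb (available-remaining-nonneg S j late) (·-nonneg N (0≤εv 0≤v)))
        where
        finished : ∀ j → available I t j - X.e j u ≈ 0#
        finished j with release j ≤? t
        ... | yes r≤t = completed⇒remaining≈0 X (completed j r≤t)
        ... | no  r≰t = x-e-before-release X j (late r≰t) 0#

    module _ {t u A} (t<u : t < u) (phase : Phase ε X t u A) {k : Job} (k∈A : k ∈ A) where
      open BusyPhase t<u phase k∈A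
      open Phase phase

      private
        released-if-served : ∀ {j} → j ∈ A → release j ≤ t
        released-if-served j∈A = proj₁ (proj₁ (processed⇒leader (chosen ≤-refl t<u) j∈A))

      potential-drops : ∀ {v} → peak ≤ ε * v → ∀ j →
        potential v (available I t j) (X.e j u) + (X.e j u - X.e j t) ≤
        potential v (available I t j) (X.e j t)
      potential-drops {v} peak≤εv j with j ∈? A
      ... | no j∉A = ≤-reflexive (≈-trans
        (+-cong (potential-cong eu≈et) (≈-trans (+-congʳ eu≈et) (-‿inverseʳ _))) (+-identityʳ _))
        where eu≈et = waiting (<⇒≤ t<u) ≤-refl j j∉A
      ... | yes j∈A rewrite available-released I {t} {j} (released-if-served j∈A) with j ≟ᶠ k
      ...   | no j≢k = potential-drop (inj₂ (inj₁ (≤-trans (κe≤peak-tied j∈A j≢k) peak≤εv)))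
      -- `peak` is a minimum of three terms; whichever of them is at most ε v supplies an
      -- alternative of `potential-drop`.
      ...   | yes ≡.refl with ⊓-≤-split peak≤εv
      ...     | inj₂ εp≤ = potential-drop (inj₂ (inj₂ εp≤))
      ...     | inj₁ ≤εv with ⊓-≤-split ≤εv
      ...       | inj₁ r≤  = potential-drop (inj₁ r≤)
      ...       | inj₂ κe≤ = potential-drop (inj₂ (inj₁ κe≤))

      -- Truncation is 1-Lipschitz in the remaining work; where the cap is active, monotonicity of
      -- the received work suffices.
      truncation-drops : ∀ x j → (available I t j - S.e j t) ⊓ x ≤
                                 (available I t j - S.e j u) ⊓ x + (S.e j u - S.e j t)
      truncation-drops x j = ≤-by
        (⊓-glb {z = x} (≤-by (x⊓y≤x (p - et) x)
                  (solve 4 (λ m p et eu →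
                    (m :- (eu :- et)) :+ (p :- et) := (p :- eu) :+ m) ≈-refl _ p et eu))
               (≤-by (+-mono-≤ (x⊓y≤y (p - et) x) (S.e-mono j (<⇒≤ t<u)))
                  (solve 4 (λ m x et eu →
                    (m :- (eu :- et)) :+ (x :+ eu) := x :+ (m :+ et)) ≈-refl _ x et eu)))
        (solve 4 (λ m m′ et eu →
          m :+ m′ := (m′ :+ (eu :- et)) :+ (m :- (eu :- et))) ≈-refl _ _ et eu)
        where
        p = available I t j
        et = S.e j t
        eu = S.e j u

      dominated-above-peak : DominatedAt t t → ∀ {v} → 0# ≤ v → peak ≤ ε * v →
        sum (λ j → potential v (available I t j) (X.e j u)) ≤
        sum (λ j → (available I t j - S.e j u) ⊓ N · (ε * v))
      dominated-above-peak dominated {v} 0≤v peak≤εv = ≤-by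
        (begin
          sum fᵤ + (u - t)                     ≈⟨ +-congˡ total-service ⟨
          sum fᵤ + sum (λ j → X.e j u - X.e j t) ≈⟨ ∑-distrib-+ fᵤ _ ⟨
          sum (λ j → fᵤ j + (X.e j u - X.e j t)) ≤⟨ sum-mono-≤ (potential-drops peak≤εv) ⟩
          sum (λ j → potential v (available I t j) (X.e j t)) ≤⟨ dominated 0≤v ⟩
          sum (λ j → (available I t j - S.e j t) ⊓ N · (ε * v))
            ≤⟨ sum-mono-≤ (truncation-drops (N · (ε * v))) ⟩
          sum (λ j → gᵤ j + (S.e j u - S.e j t)) ≈⟨ ∑-distrib-+ gᵤ _ ⟩
          sum gᵤ + sum (λ j → S.e j u - S.e j t) ≤⟨ +-mono-≤ ≤-refl (S.unit-speed (<⇒≤ t<u)) ⟩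
          sum gᵤ + (u - t)                     ∎)
        (solve 3 (λ f g d → f :+ (g :+ d) := g :+ (f :+ d)) ≈-refl (sum fᵤ) (sum gᵤ) (u - t))
        where
        open ≤-Reasoning
        fᵤ gᵤ : Job → Carrier
        fᵤ j = potential v (available I t j) (X.e j u)
        gᵤ j = (available I t j - S.e j u) ⊓ N · (ε * v)

      -- At u every potential with ε v ≤ `peak` is just the truncated remaining work, and for all
      -- jobs but k this work is 0 or at least `peak`. Hence `truncated-sum-≤` carries the
      -- inequality down from the threshold `peak`.
      dominated-below-peak : DominatedAt t t → ∀ {v} → 0# ≤ v → ε * v ≤ peak →
        sum (λ j → potential v (available I t j) (X.e j u)) ≤
        sum (λ j → (available I t j - S.e j u) ⊓ N · (ε * v))
      dominated-below-peak dominated {v} 0≤v εv≤peak = ≤-trans (sum-mono-≤ full) (truncated-sum-≤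
        (λ j → available I t j - X.e j u) (λ j → available I t j - S.e j u) N (0≤εv 0≤v) εv≤peak
        (λ j → available-remaining-nonneg S j released-early) k full-or-completed at-peak)
        where
        -- The parameter whose threshold ε w is exactly `peak`, so that `dominated-above-peak`
        -- covers it.
        w : Carrier
        w = ε ⁻¹ * peak
        εw≈peak : ε * w ≈ peak
        εw≈peak = *-⁻¹-cancelˡ 0<ε peak
        0≤w : 0# ≤ w
        0≤w = *-nonneg (<⇒≤ (⁻¹-pos 0<ε)) (≤-trans (0≤εv 0≤v) εv≤peak)
        full : ∀ j → potential v (available I t j) (X.e j u) ≤ (available I t j - X.e j u) ⊓ (ε * v)
        full j with release j ≤? t
        ... | no r≰t = potential-≤⊓-completed 0≤v
          (x-e-before-release X j (released-early r≰t) 0#)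
        ... | yes r≤t with j ≟ᶠ k
        ...   | yes ≡.refl = potential-≤⊓ (≤-trans εv≤peak peak≤κe)
        ...   | no j≢k with above-peak j≢k r≤t
        ...     | inj₁ eu≈p          = potential-≤⊓-completed 0≤v (completed⇒remaining≈0 X eu≈p)
        ...     | inj₂ (_ , peak≤κeⱼ) = potential-≤⊓ (≤-trans εv≤peak peak≤κeⱼ)
        full-or-completed : ∀ j → j ≢ k →
          available I t j - X.e j u ≈ 0# ⊎ peak ≤ available I t j - X.e j u
        full-or-completed j j≢k with release j ≤? t
        ... | no r≰t = inj₁ (x-e-before-release X j (released-early r≰t) 0#)
        ... | yes r≤t with above-peak j≢k r≤t
        ...   | inj₁ eu≈p         = inj₁ (completed⇒remaining≈0 X eu≈p)
        ...   | inj₂ (peak≤r , _) = inj₂ peak≤r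
        at-peak : sum (λ j → (available I t j - X.e j u) ⊓ peak) ≤
                  sum (λ j → (available I t j - S.e j u) ⊓ N · peak)
        at-peak = ≤-trans
          (sum-mono-≤ λ j → ≤-trans (≤-reflexive (⊓-congˡ _ (≈-sym εw≈peak)))
                                    (⊓≤potential w (available I t j) (X.e j u)))
          (≤-trans (dominated-above-peak dominated 0≤w (≤-reflexive (≈-sym εw≈peak)))
                   (sum-mono-≤ λ j → ≤-reflexive
                     (⊓-congˡ (available I t j - S.e j u) (·-congʳ N εw≈peak))))

      dominated-busy : DominatedAt t t → DominatedAt u u
      dominated-busy dominated = dominated-arrivals t<u released-early λ {v} 0≤v →
        case total (ε * v) peak of λ where
          (inj₁ εv≤peak) → dominated-below-peak dominated 0≤v εv≤peak
          (inj₂ peak≤εv) → dominated-above-peak dominated 0≤v peak≤εv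

    -- If A is empty, no job is active at t and none arrives before u, since any active job would
    -- force a nonempty choice.
    dominated-phase : ∀ {t u A} → t < u → Phase ε X t u A → DominatedAt t t → DominatedAt u u
    dominated-phase {t} {u} {A} t<u phase dominated with nonempty? A
    ... | yes (k , k∈A) = dominated-busy t<u phase k∈A dominated
    ... | no  empty     = dominated-arrivals t<u late (dominated-idle t<u late λ j r≤t →
      ≈-trans (waiting (<⇒≤ t<u) ≤-refl j λ j∈A → empty (j , j∈A))
              (inactive⇒completed X r≤t λ active → empty (busy (chosen ≤-refl t<u) active)))
      where
      open Phase phase
      late : ∀ {j} → ¬ release j ≤ t → u ≤ release j
      late {j} r≰t = ≮⇒≥ λ r<u → empty (busy (chosen (<⇒≤ (≰⇒> r≰t)) r<u) (active-at-release X j))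

    dominated-resp-≈ : ∀ {t u} → t ≈ u → DominatedAt t t → DominatedAt u u
    dominated-resp-≈ {t} {u} t≈u dominated {v} 0≤v = ≤-trans
      (sum-mono-≤ λ j → ≤-reflexive (≈-trans (potential-cong (e-cong X j (≈-sym t≈u)))
        (≈-reflexive (≡.cong (λ p → potential v p (X.e j t)) (≡.sym (available-≡ j))))))
      (≤-trans (dominated 0≤v)
        (sum-mono-≤ λ j → ≤-reflexive (⊓-congʳ _ (+-cong (≈-reflexive (available-≡ j))
          (-‿cong (e-cong S j t≈u))))))
      where
      available-≡ : ∀ j → available I t j ≡ available I u j
      available-≡ j with release j ≤? t
      ... | yes r≤t = ≡.sym (available-released I (≤-respʳ-≈ t≈u r≤t))
      ... | no  r≰t = ≡.sym (available-unreleased I (r≰t ∘ ≤-respʳ-≈ (≈-sym t≈u)))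

    dominated-phases : ∀ {t u} → Phases ε X t u → DominatedAt t t → DominatedAt u u
    dominated-phases ([] t≈u) = dominated-resp-≈ t≈u
    dominated-phases ((t<u , _ , phase) ∷ phases) =
      dominated-phases phases ∘ dominated-phase t<u phase

    -- At the threshold b every active job of SLF contributes exactly b, and every active job of S
    -- at most N b. Dividing by b leaves the cardinalities.
    dominated⇒competitive : ∀ {t} → DominatedAt t t → ∣ X.activeSet t ∣ ≤ℕ N *ℕ ∣ S.activeSet t ∣
    dominated⇒competitive {t} dominated
      with positive-bound (λ j → size j - X.e j t)
    ... | b , 0<b , b≤r = ≡.subst (∣ X.activeSet t ∣ ≤ℕ_) (ℕ.*-comm ∣ S.activeSet t ∣ N)
      (·-cancelʳ-≤ 0<b ∣ X.activeSet t ∣ (∣ S.activeSet t ∣ *ℕ N) (begin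
        ∣ X.activeSet t ∣ · b
          ≤⟨ count·≤sum (λ j → X.active? j t) active-large
               (λ j → ⊓-glb (available-remaining-nonneg X j (<⇒≤ ∘ ≰⇒>)) (0≤εv 0≤v)) ⟩
        sum (λ j → (available I t j - X.e j t) ⊓ (ε * v))
          ≤⟨ sum-mono-≤ (λ j → ⊓≤potential v (available I t j) (X.e j t)) ⟩
        sum (λ j → potential v (available I t j) (X.e j t))
          ≤⟨ dominated 0≤v ⟩
        sum (λ j → (available I t j - S.e j t) ⊓ N · (ε * v))
          ≤⟨ sum≤count· (λ j → S.active? j t)
               (λ j _ → ≤-trans (x⊓y≤y _ _) (≤-reflexive (·-congʳ N εv≈b)))
               (λ j inactive → ≤-trans (x⊓y≤x _ _) (≤-reflexive (inactive-finished j inactive))) ⟩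
        ∣ S.activeSet t ∣ · (N · b)
          ≈⟨ ·-assocˡ b ∣ S.activeSet t ∣ N ⟩
        (∣ S.activeSet t ∣ *ℕ N) · b ∎))
      where
      open ≤-Reasoning
      v : Carrier
      v = ε ⁻¹ * b
      0≤v : 0# ≤ v
      0≤v = <⇒≤ (*-pos (⁻¹-pos 0<ε) 0<b)
      εv≈b : ε * v ≈ b
      εv≈b = *-⁻¹-cancelˡ 0<ε b
      active-large : ∀ j → X.Active j t → b ≤ (available I t j - X.e j t) ⊓ (ε * v)
      active-large j (r≤t , e<p) rewrite available-released I {t} {j} r≤t =
        ⊓-glb (b≤r j (x<y⇒0<y-x e<p)) (≤-reflexive (≈-sym εv≈b))
      inactive-finished : ∀ j → ¬ S.Active j t → available I t j - S.e j t ≈ 0#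
      inactive-finished j inactive with release j ≤? t
      ... | yes r≤t = completed⇒remaining≈0 S (inactive⇒completed S r≤t inactive)
      ... | no  r≰t = x-e-before-release S j (<⇒≤ (≰⇒> r≰t)) 0#

    competitive : IsSLF ε X → ∀ t → ∣ X.activeSet t ∣ ≤ℕ N *ℕ ∣ S.activeSet t ∣
    competitive slf t = dominated⇒competitive (case total 0# t of λ where
      (inj₁ 0≤t) → dominated-phases (slf t 0≤t) (dominated-start ≤-refl)
      -- Phases start at 0; up to then no work has been done in either schedule.
      (inj₂ t≤0) → dominated-start t≤0)

lemma3p1 : ∀ {c ℓ₁ ℓ₂} (F : ArchimedeanOrderedField c ℓ₁ ℓ₂) →
  let open ArchimedeanOrderedField F
      open Scheduling F
  in (ε : Carrier) → 0# < ε → ε < 1# →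
     (I : Instance) (SLF OPT : Schedule I) →
     IsSLF ε SLF → IsOptimal OPT →
     (t : Carrier) →
     ∣ activeSet SLF t ∣ ≤ℕ ⌈ ε ⁻¹ ⌉ *ℕ ∣ activeSet OPT t ∣
lemma3p1 F ε 0<ε ε<1 I SLF OPT slf _ = Algorithm.Competitiveness.competitive F ε 0<ε ε<1 SLF OPT slf
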